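{- The theory $\mathrm{RCA}_0^{\Omega}$ proves the equivalences $$\Pi^0_1\text{ -TRANS}\leftrightarrow \Sigma^0_1\text{ -SEP}^{*}\leftrightarrow \mathrm{U}\Sigma^0_1\text{ -SEP}\leftrightarrow (\exists^{2}).$$
   Context: BASE THEORY. Finite types: $0$ (natural numbers), $\sigma\to\tau$, and $\sigma^{*}$ (finite sequences of objects of type $\sigma$); $1=0\to 0$, $2=1\to 0$, $3=2\to 0$. Superscripts indicate types; tuples are coded as single objects where convenient. Equality $=_0$ is primitive; for $\tau=\tau_1\to\dots\to\tau_k\to 0$, $x=_\tau y$ means $(\forall z_1\dots z_k)(xz_1\dots z_k=_0 yz_1\dots z_k)$. $\mathrm{RCA}_0^{\omega}$ is Kohlenbach's higher-order base theory: classical arithmetic in all finite types with combinators, zero, successor, the recursor $R_0$ (primitive recursion with type $0$ values), quantifier-free induction, extensionality $x=_\rho y\to\varphi(x)=_\tau\varphi(y)$ for all $\varphi^{\rho\to\tau}$, and $\mathrm{QF\text{ - }AC}^{1,0}$, where $\mathrm{QF\text{ - }AC}^{\sigma,\tau}$ is $(\forall x^\sigma)(\exists y^\tau)A_0(x,y)\to(\exists F^{\sigma\to\tau})(\forall x)A_0(x,F(x))$ for quantifier-free $A_0$. $\mathrm{RCA}_0^{\Omega}$ extends $\mathrm{RCA}_0^{\omega}$ (with the types $\sigma^*$) by a predicate $\mathrm{st}$ ("is standard") for each type. A formula is internal if it does not contain $\mathrm{st}$; $(\forall^{\mathrm{st}}x)A$ is $(\forall x)(\mathrm{st}(x)\to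 A)$, $(\exists^{\mathrm{st}}x)A$ is $(\exists x)(\mathrm{st}(x)\wedge A)$; $N\in\Omega$ means $\neg\mathrm{st}(N^0)$; $A^{\mathrm{st}}$ is $A$ with all quantifiers (except bounded number quantifiers) relativised to $\mathrm{st}$. Axioms: (i) standardness respects equality, closed terms are standard, a standard functional applied to a standard object is standard, and numbers below a standard number are standard; (ii) Idealization: $(\forall^{\mathrm{st}}x^{\sigma^*})(\exists y^\tau)(\forall z\in x)\varphi(z,y)\to(\exists y)(\forall^{\mathrm{st}}z^{\sigma})\varphi(z,y)$ for internal $\varphi$; (iii) $\mathrm{HAC}_{\mathrm{int}}$: $(\forall^{\mathrm{st}}x^{\rho})(\exists^{\mathrm{st}}y^{\tau})\varphi(x,y)\to(\exists^{\mathrm{st}}\Phi^{\rho\to\tau^*})(\forall^{\mathrm{st}}x)(\exists y\in\Phi(x))\varphi(x,y)$ for internal $\varphi$; (iv) $\mathrm{PF\text{ - }TP}_\forall$: $(\forall^{\mathrm{st}}x^\tau)\varphi(x)\to(\forall x^\tau)\varphi(x)$ for internal $\varphi(x)$ with no parameters other than $x$; (v) for certain functionals uniquely specified by a parameter-free internal formula $D$ (e.g. the one in $(\exists^2)$), a constant $\Xi_0$ with the axiom $\mathrm{st}(\Xi_0)\wedge(\forall^{\mathrm{st}}\Xi)[D^{\mathrm{st}}(\Xi)\to \Xi_0$ and $\Xi$ agree on all standard inputs$]$; these constants do not count as parameters in (iv). PRINCIPLES (sets $Z^1$ are given by characteristic functions). $(\exists^2)$: $(\exists\varphi^2)(\forall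 g^1)[(\exists x^0)g(x)=0\leftrightarrow\varphi(g)=0]$. $\Pi^0_1\text{ -TRANS}$: $(\forall^{\mathrm{st}}f^1)[(\forall^{\mathrm{st}}n^0)f(n)=0\to(\forall n^0)f(n)=0]$. $\Sigma^0_1\text{ -SEP}^*$: for all standard $f_1^1,f_2^1$ and $\varphi_i(n)\equiv(\exists n_i)(f_i(n_i,n)=0)$ such that $(\forall^{\mathrm{st}}n)\neg[\varphi_1^{\mathrm{st}}(n)\wedge\varphi_2^{\mathrm{st}}(n)]$, there is a standard $Z^1$ such that $(\forall n^0)[(\varphi_1(n)\to n\notin Z)\wedge(\varphi_2(n)\to n\in Z)]$. $\mathrm{U}\Sigma^0_1\text{ -SEP}$: for $\varphi_i(n,f)\equiv(\exists n_i)(f(n_i,n)=0)$, $i=1,2$, $$(\exists F^{(1\times1\times0)\to0})(\forall f^1,g^1)\big[(\forall n)\neg[\varphi_1(n,f)\wedge\varphi_2(n,g)]\to(\forall n)[\varphi_1(n,f)\to F(f,g,n)=1]\wedge(\forall n)[\varphi_2(n,g)\to F(f,g,n)=0]\big].$$ -}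

module Defs where

open import Data.Empty using (⊥)
open import Data.List using (List; []; _∷_; map)
open import Data.List.Membership.Propositional using (_∈_)
open import Data.List.Relation.Binary.Subset.Propositional using (_⊆_)
open import Data.List.Relation.Unary.Any using (here; there)
open import Data.Product using (_×_)
open import Data.Unit using (⊤)
open import Relation.Binary.PropositionalEquality using (_≡_; refl)

infixr 30 _⇒_
infix  35 _*
infixl 25 _·_
infixl 22 _+ᵗ_ _∸ᵗ_
infix  18 _≐_ _≤ᶠ_ _<ᶠ_ _∈ᶠ_ _∈ˢ_
infix  17 ¬ᶠ_
infixr 16 _∧_
infixr 15 _∨_
infixr 14 _⊃_
infix  13 _⇔_
infixr 12 ∀[_]_ ∃[_]_ ∀<[_]_ ∃<[_]_ ∀ˢᵗ[_]_ ∃ˢᵗ[_]_ ∀∈[_]_ ∃∈[_]_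
infix  5 _⨾_⊢_ _⊢_

------------------------------------------------------------------------
-- Types, terms, formulas

data Ty : Set where
  𝟎   : Ty
  _⇒_ : Ty → Ty → Ty
  _*  : Ty → Ty

𝟏 𝟐 : Ty
𝟏 = 𝟎 ⇒ 𝟎
𝟐 = 𝟏 ⇒ 𝟎

Ctx : Set
Ctx = List Ty

-- A signature is a family of constants available in addition to those of
-- the base theory.
Sig : Set₁
Sig = Ty → Set

∅ : Sig
∅ _ = ⊥

variable
  Γ Δ   : Ctx
  ρ σ τ : Ty
  𝒦     : Sig

-- A variable is its position in the context (innermost binder first).
-- Terms are combinatory, hence without binders.
-- A finite sequence of type σ * has a length `len`, entries `nth` (only the
-- entries below the length are meaningful) and can be built either by
-- `nil`, `cons` or as the initial segment `init g n` = ⟨g 0, …, g (n-1)⟩.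
-- There is no recursion besides R₀, whose values have type 0.
data Tm (𝒦 : Sig) (Γ : Ctx) : Ty → Set where
  var  : τ ∈ Γ → Tm 𝒦 Γ τ
  con  : 𝒦 τ → Tm 𝒦 Γ τ
  _·_  : Tm 𝒦 Γ (σ ⇒ τ) → Tm 𝒦 Γ σ → Tm 𝒦 Γ τ
  O    : Tm 𝒦 Γ 𝟎
  S    : Tm 𝒦 Γ (𝟎 ⇒ 𝟎)
  𝐊    : Tm 𝒦 Γ (σ ⇒ τ ⇒ σ)
  𝐒    : Tm 𝒦 Γ ((ρ ⇒ σ ⇒ τ) ⇒ (ρ ⇒ σ) ⇒ ρ ⇒ τ)
  R₀   : Tm 𝒦 Γ (𝟎 ⇒ 𝟎 ⇒ (𝟎 ⇒ 𝟎 ⇒ 𝟎) ⇒ 𝟎)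
  nil  : Tm 𝒦 Γ (σ *)
  cons : Tm 𝒦 Γ (σ ⇒ σ * ⇒ σ *)
  len  : Tm 𝒦 Γ (σ * ⇒ 𝟎)
  nth  : Tm 𝒦 Γ (σ * ⇒ 𝟎 ⇒ σ)
  init : Tm 𝒦 Γ ((𝟎 ⇒ σ) ⇒ 𝟎 ⇒ σ *)

-- Bounded number quantifiers are kept as formula formers because
-- relativisation to the standard objects must recognise them.
data Form (𝒦 : Sig) : Ctx → Set where
  _≐_     : Tm 𝒦 Γ 𝟎 → Tm 𝒦 Γ 𝟎 → Form 𝒦 Γ
  st      : Tm 𝒦 Γ τ → Form 𝒦 Γ
  falsum  : Form 𝒦 Γ
  _∧_     : Form 𝒦 Γ → Form 𝒦 Γ → Form 𝒦 Γ
  _∨_     : Form 𝒦 Γ → Form 𝒦 Γ → Form 𝒦 Γ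
  _⊃_     : Form 𝒦 Γ → Form 𝒦 Γ → Form 𝒦 Γ
  ∀[_]_   : (τ : Ty) → Form 𝒦 (τ ∷ Γ) → Form 𝒦 Γ
  ∃[_]_   : (τ : Ty) → Form 𝒦 (τ ∷ Γ) → Form 𝒦 Γ
  ∀<[_]_  : Tm 𝒦 Γ 𝟎 → Form 𝒦 (𝟎 ∷ Γ) → Form 𝒦 Γ
  ∃<[_]_  : Tm 𝒦 Γ 𝟎 → Form 𝒦 (𝟎 ∷ Γ) → Form 𝒦 Γ

Sentence : Sig → Set
Sentence 𝒦 = Form 𝒦 []

------------------------------------------------------------------------
-- Renaming and substitution

Sub : Sig → Ctx → Ctx → Set
Sub 𝒦 Γ Δ = ∀ {τ} → τ ∈ Γ → Tm 𝒦 Δ τ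

renT : Γ ⊆ Δ → Tm 𝒦 Γ τ → Tm 𝒦 Δ τ
renT r (var i) = var (r i)
renT r (con c) = con c
renT r (t · u) = renT r t · renT r u
renT r O       = O
renT r S       = S
renT r 𝐊       = 𝐊
renT r 𝐒       = 𝐒
renT r R₀      = R₀
renT r nil     = nil
renT r cons    = cons
renT r len     = len
renT r nth     = nth
renT r init    = init

subT : Sub 𝒦 Γ Δ → Tm 𝒦 Γ τ → Tm 𝒦 Δ τ
subT s (var i) = s i
subT s (con c) = con c
subT s (t · u) = subT s t · subT s u
subT s O       = O
subT s S       = S
subT s 𝐊       = 𝐊
subT s 𝐒       = 𝐒
subT s R₀      = R₀
subT s nil     = nil
subT s cons    = cons
subT s len     = len
subT s nth     = nth
subT s init    = init

liftR : Γ ⊆ Δ → (σ ∷ Γ) ⊆ (σ ∷ Δ)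
liftR r (here e)  = here e
liftR r (there i) = there (r i)

wkT : Tm 𝒦 Γ τ → Tm 𝒦 (σ ∷ Γ) τ
wkT = renT there

liftS : Sub 𝒦 Γ Δ → Sub 𝒦 (σ ∷ Γ) (σ ∷ Δ)
liftS s (here e)  = var (here e)
liftS s (there i) = wkT (s i)

ren : Γ ⊆ Δ → Form 𝒦 Γ → Form 𝒦 Δ
ren r (t ≐ u)      = renT r t ≐ renT r u
ren r (st t)       = st (renT r t)
ren r falsum       = falsum
ren r (A ∧ B)      = ren r A ∧ ren r B
ren r (A ∨ B)      = ren r A ∨ ren r B
ren r (A ⊃ B)      = ren r A ⊃ ren r B
ren r (∀[ τ ] A)   = ∀[ τ ] ren (liftR r) A
ren r (∃[ τ ] A)   = ∃[ τ ] ren (liftR r) A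
ren r (∀<[ t ] A)  = ∀<[ renT r t ] ren (liftR r) A
ren r (∃<[ t ] A)  = ∃<[ renT r t ] ren (liftR r) A

sub : Sub 𝒦 Γ Δ → Form 𝒦 Γ → Form 𝒦 Δ
sub s (t ≐ u)      = subT s t ≐ subT s u
sub s (st t)       = st (subT s t)
sub s falsum       = falsum
sub s (A ∧ B)      = sub s A ∧ sub s B
sub s (A ∨ B)      = sub s A ∨ sub s B
sub s (A ⊃ B)      = sub s A ⊃ sub s B
sub s (∀[ τ ] A)   = ∀[ τ ] sub (liftS s) A
sub s (∃[ τ ] A)   = ∃[ τ ] sub (liftS s) A
sub s (∀<[ t ] A)  = ∀<[ subT s t ] sub (liftS s) A
sub s (∃<[ t ] A)  = ∃<[ subT s t ] sub (liftS s) A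

wk : Form 𝒦 Γ → Form 𝒦 (σ ∷ Γ)
wk = ren there

from[] : [] ⊆ Γ
from[] ()

inst : Tm 𝒦 Γ σ → Sub 𝒦 (σ ∷ Γ) Γ
inst t (here refl) = t
inst t (there i)   = var i

_[_] : Form 𝒦 (σ ∷ Γ) → Tm 𝒦 Γ σ → Form 𝒦 Γ
A [ t ] = sub (inst t) A

v0 : Tm 𝒦 (τ ∷ Γ) τ
v0 = var (here refl)

v1 : Tm 𝒦 (σ ∷ τ ∷ Γ) τ
v1 = wkT v0

v2 : Tm 𝒦 (ρ ∷ σ ∷ τ ∷ Γ) τ
v2 = wkT v1

v3 : ∀ {π} → Tm 𝒦 (π ∷ ρ ∷ σ ∷ τ ∷ Γ) τ
v3 = wkT v2

embedT : Tm ∅ Γ τ → Tm 𝒦 Γ τ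
embedT (var i) = var i
embedT (con ())
embedT (t · u) = embedT t · embedT u
embedT O       = O
embedT S       = S
embedT 𝐊       = 𝐊
embedT 𝐒       = 𝐒
embedT R₀      = R₀
embedT nil     = nil
embedT cons    = cons
embedT len     = len
embedT nth     = nth
embedT init    = init

embed : Form ∅ Γ → Form 𝒦 Γ
embed (t ≐ u)      = embedT t ≐ embedT u
embed (st t)       = st (embedT t)
embed falsum       = falsum
embed (A ∧ B)      = embed A ∧ embed B
embed (A ∨ B)      = embed A ∨ embed B
embed (A ⊃ B)      = embed A ⊃ embed B
embed (∀[ τ ] A)   = ∀[ τ ] embed A
embed (∃[ τ ] A)   = ∃[ τ ] embed A
embed (∀<[ t ] A)  = ∀<[ embedT t ] embed A
embed (∃<[ t ] A)  = ∃<[ embedT t ] embed A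

------------------------------------------------------------------------
-- Abbreviations

-- Bracket abstraction: λ-notation for combinatory terms.
ƛ : Tm 𝒦 (σ ∷ Γ) τ → Tm 𝒦 Γ (σ ⇒ τ)
ƛ {σ = σ} (var (here refl)) = 𝐒 · 𝐊 · 𝐊 {τ = σ}
ƛ (var (there i)) = 𝐊 · var i
ƛ (con c)         = 𝐊 · con c
ƛ (t · u)         = 𝐒 · ƛ t · ƛ u
ƛ O               = 𝐊 · O
ƛ S               = 𝐊 · S
ƛ 𝐊               = 𝐊 · 𝐊
ƛ 𝐒               = 𝐊 · 𝐒
ƛ R₀              = 𝐊 · R₀
ƛ nil             = 𝐊 · nil
ƛ cons            = 𝐊 · cons
ƛ len             = 𝐊 · len
ƛ nth             = 𝐊 · nth
ƛ init            = 𝐊 · init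

_+ᵗ_ : Tm 𝒦 Γ 𝟎 → Tm 𝒦 Γ 𝟎 → Tm 𝒦 Γ 𝟎
s +ᵗ t = R₀ · t · s · ƛ (ƛ (S · v1))

pred : Tm 𝒦 Γ 𝟎 → Tm 𝒦 Γ 𝟎
pred t = R₀ · t · O · ƛ (ƛ v0)

_∸ᵗ_ : Tm 𝒦 Γ 𝟎 → Tm 𝒦 Γ 𝟎 → Tm 𝒦 Γ 𝟎
s ∸ᵗ t = R₀ · t · s · ƛ (ƛ (pred v1))

triangle : Tm 𝒦 Γ 𝟎 → Tm 𝒦 Γ 𝟎
triangle t = R₀ · t · O · ƛ (ƛ (v1 +ᵗ S · v0))

-- Cantor's pairing (m + n)(m + n + 1)/2 + m.
⟨_,_⟩ : Tm 𝒦 Γ 𝟎 → Tm 𝒦 Γ 𝟎 → Tm 𝒦 Γ 𝟎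
⟨ s , t ⟩ = triangle (s +ᵗ t) +ᵗ s

_≤ᶠ_ _<ᶠ_ : Tm 𝒦 Γ 𝟎 → Tm 𝒦 Γ 𝟎 → Form 𝒦 Γ
s ≤ᶠ t = s ∸ᵗ t ≐ O
s <ᶠ t = S · s ≤ᶠ t

¬ᶠ_ : Form 𝒦 Γ → Form 𝒦 Γ
¬ᶠ A = A ⊃ falsum

_⇔_ : Form 𝒦 Γ → Form 𝒦 Γ → Form 𝒦 Γ
A ⇔ B = (A ⊃ B) ∧ (B ⊃ A)

∀ˢᵗ[_]_ ∃ˢᵗ[_]_ : (τ : Ty) → Form 𝒦 (τ ∷ Γ) → Form 𝒦 Γ
∀ˢᵗ[ τ ] A = ∀[ τ ] (st v0 ⊃ A)
∃ˢᵗ[ τ ] A = ∃[ τ ] (st v0 ∧ A)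

-- Equality is pointwise at function types and entrywise at sequence types.
Eq : (τ : Ty) → Tm 𝒦 Γ τ → Tm 𝒦 Γ τ → Form 𝒦 Γ
Eq 𝟎       s t = s ≐ t
Eq (σ ⇒ τ) s t = ∀[ σ ] Eq τ (wkT s · v0) (wkT t · v0)
Eq (σ *)   s t = (len · s ≐ len · t) ∧
                 (∀<[ len · s ] Eq σ (nth · wkT s · v0) (nth · wkT t · v0))

_∈ᶠ_ : Tm 𝒦 Γ σ → Tm 𝒦 Γ (σ *) → Form 𝒦 Γ
s ∈ᶠ t = ∃<[ len · t ] Eq _ (wkT s) (nth · wkT t · v0)

∀∈[_]_ ∃∈[_]_ : Tm 𝒦 Γ (σ *) → Form 𝒦 (σ ∷ Γ) → Form 𝒦 Γ
∀∈[ t ] A = ∀[ _ ] (v0 ∈ᶠ wkT t ⊃ A)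
∃∈[ t ] A = ∃[ _ ] (v0 ∈ᶠ wkT t ∧ A)

Internal : Form 𝒦 Γ → Set
Internal (t ≐ u)     = ⊤
Internal (st t)      = ⊥
Internal falsum      = ⊤
Internal (A ∧ B)     = Internal A × Internal B
Internal (A ∨ B)     = Internal A × Internal B
Internal (A ⊃ B)     = Internal A × Internal B
Internal (∀[ τ ] A)  = Internal A
Internal (∃[ τ ] A)  = Internal A
Internal (∀<[ t ] A) = Internal A
Internal (∃<[ t ] A) = Internal A

-- Quantifier-free internal formulas.
QF : Form 𝒦 Γ → Set
QF (t ≐ u)     = ⊤
QF (st t)      = ⊥
QF falsum      = ⊤
QF (A ∧ B)     = QF A × QF B
QF (A ∨ B)     = QF A × QF B
QF (A ⊃ B)     = QF A × QF B
QF (∀[ τ ] A)  = ⊥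
QF (∃[ τ ] A)  = ⊥
QF (∀<[ t ] A) = ⊥
QF (∃<[ t ] A) = ⊥

_ˢᵗ : Form 𝒦 Γ → Form 𝒦 Γ
(t ≐ u) ˢᵗ     = t ≐ u
(st t) ˢᵗ      = st t
falsum ˢᵗ      = falsum
(A ∧ B) ˢᵗ     = (A ˢᵗ) ∧ (B ˢᵗ)
(A ∨ B) ˢᵗ     = (A ˢᵗ) ∨ (B ˢᵗ)
(A ⊃ B) ˢᵗ     = (A ˢᵗ) ⊃ (B ˢᵗ)
(∀[ τ ] A) ˢᵗ  = ∀ˢᵗ[ τ ] (A ˢᵗ)
(∃[ τ ] A) ˢᵗ  = ∃ˢᵗ[ τ ] (A ˢᵗ)
(∀<[ t ] A) ˢᵗ = ∀<[ t ] (A ˢᵗ)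
(∃<[ t ] A) ˢᵗ = ∃<[ t ] (A ˢᵗ)

------------------------------------------------------------------------
-- Derivability: classical natural deduction

-- Axioms may have free variables: an instance in context Γ stands for its
-- universal closure.
Theory : Sig → Set₁
Theory 𝒦 = ∀ {Γ} → Form 𝒦 Γ → Set

data _⨾_⊢_ {𝒦 : Sig} (T : Theory 𝒦) {Γ : Ctx} (H : List (Form 𝒦 Γ)) :
           Form 𝒦 Γ → Set

_⊢_ : Theory 𝒦 → Sentence 𝒦 → Set
T ⊢ A = T ⨾ [] ⊢ A

data _⨾_⊢_ {𝒦} T {Γ} H where
  axiom : ∀ {A} → T A → T ⨾ H ⊢ A
  hyp   : ∀ {A} → A ∈ H → T ⨾ H ⊢ A
  raa   : ∀ {A} → T ⨾ (¬ᶠ A ∷ H) ⊢ falsum → T ⨾ H ⊢ A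
  ⊃I    : ∀ {A B} → T ⨾ (A ∷ H) ⊢ B → T ⨾ H ⊢ A ⊃ B
  ⊃E    : ∀ {A B} → T ⨾ H ⊢ A ⊃ B → T ⨾ H ⊢ A → T ⨾ H ⊢ B
  ∧I    : ∀ {A B} → T ⨾ H ⊢ A → T ⨾ H ⊢ B → T ⨾ H ⊢ A ∧ B
  ∧E₁   : ∀ {A B} → T ⨾ H ⊢ A ∧ B → T ⨾ H ⊢ A
  ∧E₂   : ∀ {A B} → T ⨾ H ⊢ A ∧ B → T ⨾ H ⊢ B
  ∨I₁   : ∀ {A B} → T ⨾ H ⊢ A → T ⨾ H ⊢ A ∨ B
  ∨I₂   : ∀ {A B} → T ⨾ H ⊢ B → T ⨾ H ⊢ A ∨ B
  ∨E    : ∀ {A B C} → T ⨾ H ⊢ A ∨ B →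
          T ⨾ (A ∷ H) ⊢ C → T ⨾ (B ∷ H) ⊢ C → T ⨾ H ⊢ C
  ∀I    : ∀ {A : Form 𝒦 (τ ∷ Γ)} → T ⨾ map wk H ⊢ A → T ⨾ H ⊢ ∀[ τ ] A
  ∀E    : ∀ {A : Form 𝒦 (τ ∷ Γ)} → T ⨾ H ⊢ ∀[ τ ] A →
          (t : Tm 𝒦 Γ τ) → T ⨾ H ⊢ A [ t ]
  ∃I    : ∀ {A : Form 𝒦 (τ ∷ Γ)} (t : Tm 𝒦 Γ τ) →
          T ⨾ H ⊢ A [ t ] → T ⨾ H ⊢ ∃[ τ ] A
  ∃E    : ∀ {A : Form 𝒦 (τ ∷ Γ)} {C} → T ⨾ H ⊢ ∃[ τ ] A →
          T ⨾ (A ∷ map wk H) ⊢ wk C → T ⨾ H ⊢ C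

------------------------------------------------------------------------
-- The base theory

succ-inst : Sub 𝒦 (𝟎 ∷ Γ) (𝟎 ∷ Γ)
succ-inst (here refl) = S · v0
succ-inst (there i)   = var (there i)

-- Turns A(x , y), with y innermost, into A(x , F x), with x innermost and
-- F next to it.
choice-inst : Sub 𝒦 (τ ∷ σ ∷ Γ) (σ ∷ (σ ⇒ τ) ∷ Γ)
choice-inst (here refl)         = v1 · v0
choice-inst (there (here refl)) = v0
choice-inst (there (there i))   = var (there (there i))

data RCA₀ω {𝒦 : Sig} {Γ : Ctx} : Form 𝒦 Γ → Set where
  ∀<-def : ∀ t (A : Form 𝒦 (𝟎 ∷ Γ)) →
           RCA₀ω ((∀<[ t ] A) ⇔ (∀[ 𝟎 ] (v0 <ᶠ wkT t ⊃ A)))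
  ∃<-def : ∀ t (A : Form 𝒦 (𝟎 ∷ Γ)) →
           RCA₀ω ((∃<[ t ] A) ⇔ (∃[ 𝟎 ] (v0 <ᶠ wkT t ∧ A)))

  ≐-refl  : ∀ s → RCA₀ω (s ≐ s)
  ≐-sym   : ∀ s t → RCA₀ω (s ≐ t ⊃ t ≐ s)
  ≐-trans : ∀ s t u → RCA₀ω (s ≐ t ⊃ t ≐ u ⊃ s ≐ u)

  S-nonzero   : ∀ s → RCA₀ω (¬ᶠ (S · s ≐ O))
  S-injective : ∀ s t → RCA₀ω (S · s ≐ S · t ⊃ s ≐ t)

  𝐊-def : ∀ (x : Tm 𝒦 Γ σ) (y : Tm 𝒦 Γ τ) → RCA₀ω (Eq σ (𝐊 · x · y) x)
  𝐒-def : ∀ (x : Tm 𝒦 Γ (ρ ⇒ σ ⇒ τ)) y z →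
          RCA₀ω (Eq τ (𝐒 · x · y · z) (x · z · (y · z)))
  R₀-O  : ∀ y z → RCA₀ω (R₀ · O · y · z ≐ y)
  R₀-S  : ∀ x y z → RCA₀ω (R₀ · (S · x) · y · z ≐ z · (R₀ · x · y · z) · x)

  len-nil  : RCA₀ω (len · nil {σ = σ} ≐ O)
  len-cons : ∀ (x : Tm 𝒦 Γ σ) s →
             RCA₀ω (len · (cons · x · s) ≐ S · (len · s))
  nth-O    : ∀ (x : Tm 𝒦 Γ σ) s → RCA₀ω (Eq σ (nth · (cons · x · s) · O) x)
  nth-S    : ∀ (x : Tm 𝒦 Γ σ) s i →
             RCA₀ω (Eq σ (nth · (cons · x · s) · (S · i)) (nth · s · i))
  len-init : ∀ (g : Tm 𝒦 Γ (𝟎 ⇒ σ)) n → RCA₀ω (len · (init · g · n) ≐ n)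
  nth-init : ∀ (g : Tm 𝒦 Γ (𝟎 ⇒ σ)) n i →
             RCA₀ω (i <ᶠ n ⊃ Eq σ (nth · (init · g · n) · i) (g · i))

  QF-induction   : ∀ (A : Form 𝒦 (𝟎 ∷ Γ)) → QF A →
                   RCA₀ω (A [ O ] ∧ (∀[ 𝟎 ] (A ⊃ sub succ-inst A)) ⊃ (∀[ 𝟎 ] A))
  extensionality : ∀ (φ : Tm 𝒦 Γ (ρ ⇒ τ)) x y →
                   RCA₀ω (Eq ρ x y ⊃ Eq τ (φ · x) (φ · y))
  QF-AC¹⁰        : ∀ (A : Form 𝒦 (𝟎 ∷ 𝟏 ∷ Γ)) → QF A →
                   RCA₀ω ((∀[ 𝟏 ] ∃[ 𝟎 ] A) ⊃
                          (∃[ 𝟏 ⇒ 𝟎 ] ∀[ 𝟏 ] sub choice-inst A))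

------------------------------------------------------------------------
-- The nonstandard theory

-- The matrix of (∃²), normalised by φ(g) ≤ 1: without this clause the
-- functional would only be determined up to its zeros.
∃²-spec : Form ∅ (𝟐 ∷ [])
∃²-spec = ∀[ 𝟏 ] (((∃[ 𝟎 ] v1 · v0 ≐ O) ⇔ v1 · v0 ≐ O) ∧
                  (v1 · v0 ≐ O ∨ v1 · v0 ≐ S · O))

-- The functionals Ξ₀ for which the theory has a constant: any collection of
-- functionals uniquely specified, provably in the base theory, by internal
-- formulas D(Ξ) of the base language with no parameters, as long as it
-- includes the functional of (∃²).
record Specification : Set₁ where
  field
    Const    : Sig
    D        : Const τ → Form ∅ (τ ∷ [])
    internal : (c : Const τ) → Internal (D c)
    unique   : (c : Const τ) →
               RCA₀ω ⊢ ∀[ τ ] ∀[ τ ] (wk (D c) ∧ ren (liftR from[]) (D c) ⊃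
                                      Eq τ v1 v0)
    E        : Const 𝟐
    D-E      : D E ≡ ∃²-spec

module _ (𝒮 : Specification) where
  open Specification 𝒮

  data RCA₀Ω {Γ : Ctx} : Form Const Γ → Set where
    base : ∀ {A} → RCA₀ω A → RCA₀Ω A

    st-Eq     : ∀ (x y : Tm Const Γ τ) → RCA₀Ω (Eq τ x y ⊃ st x ⊃ st y)
    st-closed : ∀ (t : Tm Const [] τ) → RCA₀Ω (st (renT from[] t))
    st-app    : ∀ (f : Tm Const Γ (σ ⇒ τ)) x → RCA₀Ω (st f ⊃ st x ⊃ st (f · x))
    st-below  : ∀ m n → RCA₀Ω (st n ⊃ m ≤ᶠ n ⊃ st m)

    idealization : ∀ (φ : Form Const (σ ∷ τ ∷ Γ)) → Internal φ →
      RCA₀Ω ((∀ˢᵗ[ σ * ] ∃[ τ ] ∀∈[ v1 ] ren (liftR (liftR there)) φ) ⊃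
             (∃[ τ ] ∀ˢᵗ[ σ ] φ))

    HACint : ∀ (φ : Form Const (τ ∷ ρ ∷ Γ)) → Internal φ →
      RCA₀Ω ((∀ˢᵗ[ ρ ] ∃ˢᵗ[ τ ] φ) ⊃
             (∃ˢᵗ[ ρ ⇒ τ * ] ∀ˢᵗ[ ρ ] ∃∈[ v1 · v0 ] ren (liftR (liftR there)) φ))

    PF-TP∀ : ∀ (φ : Form Const (τ ∷ [])) → Internal φ →
      RCA₀Ω (ren from[] ((∀ˢᵗ[ τ ] φ) ⊃ (∀[ τ ] φ)))

    Ξ₀-axiom : ∀ (c : Const τ) →
      RCA₀Ω (st (con c) ∧
             (∀ˢᵗ[ τ ] (ren (liftR from[]) (embed (D c)) ˢᵗ ⊃
                        Eq τ (con c) v0 ˢᵗ)))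

------------------------------------------------------------------------
-- The principles

∃² : Sentence 𝒦
∃² = ∃[ 𝟐 ] ∀[ 𝟏 ] ((∃[ 𝟎 ] v1 · v0 ≐ O) ⇔ v1 · v0 ≐ O)

Π⁰₁-TRANS : Sentence 𝒦
Π⁰₁-TRANS = ∀ˢᵗ[ 𝟏 ] ((∀ˢᵗ[ 𝟎 ] v1 · v0 ≐ O) ⊃ (∀[ 𝟎 ] v1 · v0 ≐ O))

-- (∃m) f(m , n) = 0, where f of type 1 takes the code of the pair.
Σ⁰₁ : Tm 𝒦 Γ 𝟏 → Tm 𝒦 Γ 𝟎 → Form 𝒦 Γ
Σ⁰₁ f n = ∃[ 𝟎 ] wkT f · ⟨ v0 , wkT n ⟩ ≐ O

IsSet : Tm 𝒦 Γ 𝟏 → Form 𝒦 Γ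
IsSet Z = ∀[ 𝟎 ] (wkT Z · v0 ≐ O ∨ wkT Z · v0 ≐ S · O)

_∈ˢ_ : Tm 𝒦 Γ 𝟎 → Tm 𝒦 Γ 𝟏 → Form 𝒦 Γ
n ∈ˢ Z = Z · n ≐ S · O

Σ⁰₁-SEP* : Sentence 𝒦
Σ⁰₁-SEP* =
  ∀ˢᵗ[ 𝟏 ] ∀ˢᵗ[ 𝟏 ]
    ((∀ˢᵗ[ 𝟎 ] ¬ᶠ ((Σ⁰₁ v2 v0 ˢᵗ) ∧ (Σ⁰₁ v1 v0 ˢᵗ))) ⊃
     (∃ˢᵗ[ 𝟏 ] (IsSet v0 ∧
                (∀[ 𝟎 ] ((Σ⁰₁ v3 v0 ⊃ ¬ᶠ (v0 ∈ˢ v1)) ∧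
                         (Σ⁰₁ v2 v0 ⊃ v0 ∈ˢ v1))))))

-- F is curried.
UΣ⁰₁-SEP : Sentence 𝒦
UΣ⁰₁-SEP =
  ∃[ 𝟏 ⇒ 𝟏 ⇒ 𝟎 ⇒ 𝟎 ] ∀[ 𝟏 ] ∀[ 𝟏 ]
    ((∀[ 𝟎 ] ¬ᶠ (Σ⁰₁ v2 v0 ∧ Σ⁰₁ v1 v0)) ⊃
     (∀[ 𝟎 ] (Σ⁰₁ v2 v0 ⊃ v3 · v2 · v1 · v0 ≐ S · O)) ∧
     (∀[ 𝟎 ] (Σ⁰₁ v1 v0 ⊃ v3 · v2 · v1 · v0 ≐ O)))

-- Π⁰₁-TRANS and HACint give a standard functional whose finite lists of
-- candidates contain a zero of every standard g that has one; searching the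
-- list decides the existence of zeros on standard inputs.  By its axiom the
-- constant for (∃²) agrees with this functional there, and PF-TP∀, applicable
-- because the constant is no parameter, extends the property to all inputs.
-- This gives (∃²) and, as the constant is standard, Σ⁰₁-SEP*.  Conversely, if
-- f vanishes on the standard numbers but not everywhere, then the formula
-- (∃m) f(m) ≠ 0, taken as both φ₁ and φ₂, contradicts Σ⁰₁-SEP*, whose hypothesis
-- sees only standard m.  UΣ⁰₁-SEP yields (∃²) by Grilliot's trick, and (∃²)
-- yields a functional finding zeros, standard without loss of generality by
-- PF-TP∀, hence Π⁰₁-TRANS.
module Submission where

open import Defs
open import Data.List using (List; []; _∷_; map)
open import Data.List.Membership.Propositional using (_∈_)
open import Data.List.Relation.Binary.Subset.Propositional using (_⊆_)
open import Data.List.Relation.Binary.Subset.Propositional.Properties using (map⁺; ∷⁺ʳ)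
open import Data.List.Relation.Unary.Any using (here; there)
open import Data.Product using (_×_; _,_)
open import Data.Unit using (tt)
open import Function using (_∘_)
open import Relation.Binary.PropositionalEquality
  using (_≡_; refl; sym; trans; cong; cong₂; subst)

-- Substitution

private
  variable
    Θ : Ctx

ext : Sub 𝒦 Γ Δ → Tm 𝒦 Δ σ → Sub 𝒦 (σ ∷ Γ) Δ
ext s t (here refl) = t
ext s t (there i)   = s i

subT-id : {s : Sub 𝒦 Γ Γ} → (∀ {σ} (i : σ ∈ Γ) → s i ≡ var i) →
          (t : Tm 𝒦 Γ τ) → subT s t ≡ t
subT-id e (var i) = e i
subT-id e (con c) = refl
subT-id e (t · u) = cong₂ _·_ (subT-id e t) (subT-id e u)
subT-id e O       = refl
subT-id e S       = refl
subT-id e 𝐊       = refl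
subT-id e 𝐒       = refl
subT-id e R₀      = refl
subT-id e nil     = refl
subT-id e cons    = refl
subT-id e len     = refl
subT-id e nth     = refl
subT-id e init    = refl

renT≡subT : {r : Γ ⊆ Δ} {s : Sub 𝒦 Γ Δ} →
            (∀ {σ} (i : σ ∈ Γ) → s i ≡ var (r i)) →
            (t : Tm 𝒦 Γ τ) → renT r t ≡ subT s t
renT≡subT e (var i) = sym (e i)
renT≡subT e (con c) = refl
renT≡subT e (t · u) = cong₂ _·_ (renT≡subT e t) (renT≡subT e u)
renT≡subT e O       = refl
renT≡subT e S       = refl
renT≡subT e 𝐊       = refl
renT≡subT e 𝐒       = refl
renT≡subT e R₀      = refl
renT≡subT e nil     = refl
renT≡subT e cons    = refl
renT≡subT e len     = refl
renT≡subT e nth     = refl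
renT≡subT e init    = refl

subT-subT : {s : Sub 𝒦 Γ Δ} {s′ : Sub 𝒦 Δ Θ} {s″ : Sub 𝒦 Γ Θ} →
            (∀ {σ} (i : σ ∈ Γ) → subT s′ (s i) ≡ s″ i) →
            (t : Tm 𝒦 Γ τ) → subT s′ (subT s t) ≡ subT s″ t
subT-subT e (var i) = e i
subT-subT e (con c) = refl
subT-subT e (t · u) = cong₂ _·_ (subT-subT e t) (subT-subT e u)
subT-subT e O       = refl
subT-subT e S       = refl
subT-subT e 𝐊       = refl
subT-subT e 𝐒       = refl
subT-subT e R₀      = refl
subT-subT e nil     = refl
subT-subT e cons    = refl
subT-subT e len     = refl
subT-subT e nth     = refl
subT-subT e init    = refl

wkT≡subT : (t : Tm 𝒦 Γ τ) → wkT {σ = σ} t ≡ subT (var ∘ there) t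
wkT≡subT = renT≡subT λ _ → refl

subT-wkT : {s : Sub 𝒦 (σ ∷ Γ) Δ} (t : Tm 𝒦 Γ τ) →
           subT s (wkT t) ≡ subT (s ∘ there) t
subT-wkT {s = s} t =
  trans (cong (subT s) (wkT≡subT t)) (subT-subT (λ _ → refl) t)

subT-inst-wkT : (u : Tm 𝒦 Γ σ) (t : Tm 𝒦 Γ τ) → subT (inst u) (wkT t) ≡ t
subT-inst-wkT u t = trans (subT-wkT t) (subT-id (λ _ → refl) t)

subT-liftS-wkT : (s : Sub 𝒦 Γ Δ) (t : Tm 𝒦 Γ τ) →
                 subT (liftS {σ = σ} s) (wkT t) ≡ wkT (subT s t)
subT-liftS-wkT s t =
  trans (subT-wkT t)
        (sym (trans (wkT≡subT (subT s t))
                    (subT-subT (λ i → sym (wkT≡subT (s i))) t)))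

liftS-id : {s : Sub 𝒦 Γ Γ} → (∀ {σ} (i : σ ∈ Γ) → s i ≡ var i) →
           ∀ {σ} (i : σ ∈ ρ ∷ Γ) → liftS s i ≡ var i
liftS-id e (here refl) = refl
liftS-id e (there i)   = cong wkT (e i)

liftS-liftR : {r : Γ ⊆ Δ} {s : Sub 𝒦 Γ Δ} →
              (∀ {σ} (i : σ ∈ Γ) → s i ≡ var (r i)) →
              ∀ {σ} (i : σ ∈ ρ ∷ Γ) → liftS s i ≡ var (liftR r i)
liftS-liftR e (here refl) = refl
liftS-liftR e (there i)   = cong wkT (e i)

liftS-subT : {s : Sub 𝒦 Γ Δ} {s′ : Sub 𝒦 Δ Θ} {s″ : Sub 𝒦 Γ Θ} →
             (∀ {σ} (i : σ ∈ Γ) → subT s′ (s i) ≡ s″ i) →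
             ∀ {σ} (i : σ ∈ ρ ∷ Γ) → subT (liftS s′) (liftS s i) ≡ liftS s″ i
liftS-subT e (here refl) = refl
liftS-subT {s = s} {s′ = s′} e (there i) =
  trans (subT-liftS-wkT s′ (s i)) (cong wkT (e i))

sub-id : {s : Sub 𝒦 Γ Γ} → (∀ {σ} (i : σ ∈ Γ) → s i ≡ var i) →
         (A : Form 𝒦 Γ) → sub s A ≡ A
sub-id e (t ≐ u)     = cong₂ _≐_ (subT-id e t) (subT-id e u)
sub-id e (st t)      = cong st (subT-id e t)
sub-id e falsum      = refl
sub-id e (A ∧ B)     = cong₂ _∧_ (sub-id e A) (sub-id e B)
sub-id e (A ∨ B)     = cong₂ _∨_ (sub-id e A) (sub-id e B)
sub-id e (A ⊃ B)     = cong₂ _⊃_ (sub-id e A) (sub-id e B)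
sub-id e (∀[ τ ] A)  = cong (∀[ τ ]_) (sub-id (liftS-id e) A)
sub-id e (∃[ τ ] A)  = cong (∃[ τ ]_) (sub-id (liftS-id e) A)
sub-id e (∀<[ t ] A) = cong₂ ∀<[_]_ (subT-id e t) (sub-id (liftS-id e) A)
sub-id e (∃<[ t ] A) = cong₂ ∃<[_]_ (subT-id e t) (sub-id (liftS-id e) A)

ren≡sub : {r : Γ ⊆ Δ} {s : Sub 𝒦 Γ Δ} →
          (∀ {σ} (i : σ ∈ Γ) → s i ≡ var (r i)) →
          (A : Form 𝒦 Γ) → ren r A ≡ sub s A
ren≡sub e (t ≐ u)     = cong₂ _≐_ (renT≡subT e t) (renT≡subT e u)
ren≡sub e (st t)      = cong st (renT≡subT e t)
ren≡sub e falsum      = refl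
ren≡sub e (A ∧ B)     = cong₂ _∧_ (ren≡sub e A) (ren≡sub e B)
ren≡sub e (A ∨ B)     = cong₂ _∨_ (ren≡sub e A) (ren≡sub e B)
ren≡sub e (A ⊃ B)     = cong₂ _⊃_ (ren≡sub e A) (ren≡sub e B)
ren≡sub e (∀[ τ ] A)  = cong (∀[ τ ]_) (ren≡sub (liftS-liftR e) A)
ren≡sub e (∃[ τ ] A)  = cong (∃[ τ ]_) (ren≡sub (liftS-liftR e) A)
ren≡sub e (∀<[ t ] A) = cong₂ ∀<[_]_ (renT≡subT e t) (ren≡sub (liftS-liftR e) A)
ren≡sub e (∃<[ t ] A) = cong₂ ∃<[_]_ (renT≡subT e t) (ren≡sub (liftS-liftR e) A)

sub-sub : {s : Sub 𝒦 Γ Δ} {s′ : Sub 𝒦 Δ Θ} {s″ : Sub 𝒦 Γ Θ} →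
          (∀ {σ} (i : σ ∈ Γ) → subT s′ (s i) ≡ s″ i) →
          (A : Form 𝒦 Γ) → sub s′ (sub s A) ≡ sub s″ A
sub-sub e (t ≐ u)     = cong₂ _≐_ (subT-subT e t) (subT-subT e u)
sub-sub e (st t)      = cong st (subT-subT e t)
sub-sub e falsum      = refl
sub-sub e (A ∧ B)     = cong₂ _∧_ (sub-sub e A) (sub-sub e B)
sub-sub e (A ∨ B)     = cong₂ _∨_ (sub-sub e A) (sub-sub e B)
sub-sub e (A ⊃ B)     = cong₂ _⊃_ (sub-sub e A) (sub-sub e B)
sub-sub e (∀[ τ ] A)  = cong (∀[ τ ]_) (sub-sub (liftS-subT e) A)
sub-sub e (∃[ τ ] A)  = cong (∃[ τ ]_) (sub-sub (liftS-subT e) A)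
sub-sub e (∀<[ t ] A) = cong₂ ∀<[_]_ (subT-subT e t) (sub-sub (liftS-subT e) A)
sub-sub e (∃<[ t ] A) = cong₂ ∃<[_]_ (subT-subT e t) (sub-sub (liftS-subT e) A)

-- `Eq` is computed by recursion on the type, so for an abstract type substitution moves past it
-- only by induction.
sub-Eq : (s : Sub 𝒦 Γ Δ) (τ : Ty) (t u : Tm 𝒦 Γ τ) →
         sub s (Eq τ t u) ≡ Eq τ (subT s t) (subT s u)
sub-Eq s 𝟎       t u = refl
sub-Eq s (σ ⇒ τ) t u = cong (∀[ σ ]_)
  (trans (sub-Eq (liftS s) τ (wkT t · v0) (wkT u · v0))
         (cong₂ (λ a b → Eq τ (a · v0) (b · v0))
                (subT-liftS-wkT s t) (subT-liftS-wkT s u)))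
sub-Eq s (σ *)   t u = cong
  (λ A → (subT s (len · t) ≐ subT s (len · u)) ∧ (∀<[ subT s (len · t) ] A))
  (trans (sub-Eq (liftS s) σ (nth · wkT t · v0) (nth · wkT u · v0))
         (cong₂ (λ a b → Eq σ (nth · a · v0) (nth · b · v0))
                (subT-liftS-wkT s t) (subT-liftS-wkT s u)))

-- The substitution left by `∀E` or `∃I` when a quantified formula, weakened once, is instantiated
-- at the innermost variable.
wk-inst-v0 : (A : Form 𝒦 (σ ∷ Γ)) → ren (liftR there) A [ v0 ] ≡ A
wk-inst-v0 A =
  trans (cong (sub (inst v0)) (ren≡sub (λ _ → refl) A))
        (trans (sub-sub {s″ = var} (λ { (here refl) → refl ; (there i) → refl }) A)
               (sub-id (λ _ → refl) A))

-- Derivations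

private
  variable
    H H′  : List (Form 𝒦 Γ)
    A B C : Form 𝒦 Γ

weaken : {T : Theory 𝒦} → H ⊆ H′ → T ⨾ H ⊢ A → T ⨾ H′ ⊢ A
weaken r (axiom a)    = axiom a
weaken r (hyp i)      = hyp (r i)
weaken r (raa d)      = raa (weaken (∷⁺ʳ _ r) d)
weaken r (⊃I d)       = ⊃I (weaken (∷⁺ʳ _ r) d)
weaken r (⊃E d e)     = ⊃E (weaken r d) (weaken r e)
weaken r (∧I d e)     = ∧I (weaken r d) (weaken r e)
weaken r (∧E₁ d)      = ∧E₁ (weaken r d)
weaken r (∧E₂ d)      = ∧E₂ (weaken r d)
weaken r (∨I₁ d)      = ∨I₁ (weaken r d)
weaken r (∨I₂ d)      = ∨I₂ (weaken r d)
weaken r (∨E d e f)   = ∨E (weaken r d) (weaken (∷⁺ʳ _ r) e) (weaken (∷⁺ʳ _ r) f)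
weaken r (∀I d)       = ∀I (weaken (map⁺ wk r) d)
weaken r (∀E d t)     = ∀E (weaken r d) t
weaken r (∃I t d)     = ∃I t (weaken r d)
weaken r (∃E d e)     = ∃E (weaken r d) (weaken (∷⁺ʳ _ (map⁺ wk r)) e)

module Logic {𝒦 : Sig} (T : Theory 𝒦) where

  infix 4 _⊩_
  _⊩_ : List (Form 𝒦 Γ) → Form 𝒦 Γ → Set
  H ⊩ A = T ⨾ H ⊢ A

  ↑_ : H ⊩ A → B ∷ H ⊩ A
  ↑_ = weaken there

  ex-falso : H ⊩ falsum → H ⊩ A
  ex-falso d = raa (↑ d)

  -- Turns a derivation into a hypothesis, which is then weakened automatically on passing below a
  -- binder.
  cut : H ⊩ A → A ∷ H ⊩ B → H ⊩ B
  cut d e = ⊃E (⊃I e) d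

  em : (A : Form 𝒦 Γ) → H ⊩ A ∨ (¬ᶠ A)
  em A = raa (⊃E (hyp (here refl))
    (∨I₂ (⊃I (⊃E (hyp (there (here refl))) (∨I₁ (hyp (here refl)))))))

  by-cases : (A : Form 𝒦 Γ) → A ∷ H ⊩ B → (¬ᶠ A) ∷ H ⊩ B → H ⊩ B
  by-cases A = ∨E (em A)

  #0 : A ∷ H ⊩ A
  #0 = hyp (here refl)

  #1 : B ∷ A ∷ H ⊩ A
  #1 = hyp (there (here refl))

  #2 : C ∷ B ∷ A ∷ H ⊩ A
  #2 = hyp (there (there (here refl)))

  #3 : ∀ {D} → D ∷ C ∷ B ∷ A ∷ H ⊩ A
  #3 = weaken there #2

  #4 : ∀ {D E} → E ∷ D ∷ C ∷ B ∷ A ∷ H ⊩ A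
  #4 = weaken there #3

  #5 : ∀ {D E F} → F ∷ E ∷ D ∷ C ∷ B ∷ A ∷ H ⊩ A
  #5 = weaken there #4

  #6 : ∀ {D E F G} → G ∷ F ∷ E ∷ D ∷ C ∷ B ∷ A ∷ H ⊩ A
  #6 = weaken there #5

  #7 : ∀ {D E F G I} → I ∷ G ∷ F ∷ E ∷ D ∷ C ∷ B ∷ A ∷ H ⊩ A
  #7 = weaken there #6

  ∃-map : {A B : Form 𝒦 (σ ∷ Γ)} → H ⊩ ∃[ σ ] A → A ∷ map wk H ⊩ B → H ⊩ ∃[ σ ] B
  ∃-map {B = B} d e =
    ∃E d (∃I v0 (subst (_ ⊩_) (sym (wk-inst-v0 B)) e))

  ∀E-v0 : {A : Form 𝒦 (σ ∷ Γ)} → H ⊩ wk (∀[ σ ] A) → H ⊩ A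
  ∀E-v0 {H = H} {A = A} d = subst (H ⊩_) (wk-inst-v0 A) (∀E d v0)

  -- Iterated `∀E` leaves `t` weakened and then instantiated, which does not compute for abstract
  -- `t`; a simultaneous substitution does.
  ∀E₂ : {A : Form 𝒦 (τ ∷ σ ∷ Γ)} → H ⊩ ∀[ σ ] ∀[ τ ] A → ∀ t u →
        H ⊩ sub (ext (ext var t) u) A
  ∀E₂ {H = H} {A = A} d t u = subst (H ⊩_)
    (sub-sub (λ { (here refl)         → refl
                ; (there (here refl)) → subT-inst-wkT u t
                ; (there (there i))   → refl }) A)
    (∀E (∀E d t) u)

  ∀E₃ : {A : Form 𝒦 (ρ ∷ τ ∷ σ ∷ Γ)} → H ⊩ ∀[ σ ] ∀[ τ ] ∀[ ρ ] A → ∀ t u v →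
        H ⊩ sub (ext (ext (ext var t) u) v) A
  ∀E₃ {H = H} {A = A} d t u v = subst (H ⊩_)
    (sub-sub (λ { (here refl)                 → refl
                ; (there (here refl))         → subT-inst-wkT v u
                ; (there (there (here refl))) → subT-inst-wkT v t
                ; (there (there (there i)))   → refl }) A)
    (∀E (∀E₂ d t u) v)

-- Equality in all finite types and combinatory reduction

module Equality {𝒦 : Sig} (T : Theory 𝒦)
                (base : ∀ {Γ} {A : Form 𝒦 Γ} → RCA₀ω A → T A) where
  open Logic T

  private
    variable
      m n k l : Tm 𝒦 Γ 𝟎

  ω : RCA₀ω A → H ⊩ A
  ω a = axiom (base a)

  ≐sym : H ⊩ m ≐ n → H ⊩ n ≐ m
  ≐sym = ⊃E (ω (≐-sym _ _))

  ≐trans : H ⊩ m ≐ n → H ⊩ n ≐ k → H ⊩ m ≐ k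
  ≐trans d e = ⊃E (⊃E (ω (≐-trans _ _ _)) d) e

  Eq-fun : (s t : Tm 𝒦 Γ (σ ⇒ τ)) → H ⊩ Eq (σ ⇒ τ) s t →
           (u : Tm 𝒦 Γ σ) → H ⊩ Eq τ (s · u) (t · u)
  Eq-fun {τ = τ} {H = H} s t d u = subst (H ⊩_)
    (trans (sub-Eq (inst u) τ _ _)
           (cong₂ (λ a b → Eq τ (a · u) (b · u))
                  (subT-inst-wkT u s) (subT-inst-wkT u t)))
    (∀E d u)

  Eq-arg : (f : Tm 𝒦 Γ (σ ⇒ τ)) (s t : Tm 𝒦 Γ σ) → H ⊩ Eq σ s t →
           H ⊩ Eq τ (f · s) (f · t)
  Eq-arg f s t = ⊃E (ω (extensionality f s t))

  -- `m <ᶠ n` unfolds to a recursion over `n` with value zero, so extensionality of `R₀` replaces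
  -- the recursion argument.
  <-respʳ : H ⊩ n ≐ k → H ⊩ m <ᶠ n → H ⊩ m <ᶠ k
  <-respʳ {m = m} d e = ≐trans
    (≐sym (Eq-fun _ _ (Eq-fun _ _ (Eq-arg R₀ _ _ d) (S · m)) (ƛ (ƛ (pred v1))))) e

  ∀<I : {A : Form 𝒦 (𝟎 ∷ Γ)} → map wk H ⊩ v0 <ᶠ wkT n ⊃ A → H ⊩ ∀<[ n ] A
  ∀<I d = ⊃E (∧E₂ (ω (∀<-def _ _))) (∀I d)

  ∀<E : {A : Form 𝒦 (𝟎 ∷ Γ)} → H ⊩ ∀<[ n ] A → H ⊩ m <ᶠ n → H ⊩ A [ m ]
  ∀<E {H = H} {n = n} {m = m} {A = A} d e = ⊃E
    (subst (λ t → H ⊩ m <ᶠ t ⊃ A [ m ]) (subT-inst-wkT m n)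
           (∀E (⊃E (∧E₁ (ω (∀<-def n A))) d) m))
    e

  ∀<E-v0 : {A : Form 𝒦 (𝟎 ∷ Γ)} → H ⊩ wk (∀<[ n ] A) → H ⊩ v0 <ᶠ wkT n → H ⊩ A
  ∀<E-v0 {H = H} {A = A} d e = subst (H ⊩_) (wk-inst-v0 A) (∀<E d e)

  Eq-refl : (τ : Ty) (s : Tm 𝒦 Γ τ) → H ⊩ Eq τ s s
  Eq-refl 𝟎       s = ω (≐-refl s)
  Eq-refl (σ ⇒ τ) s = ∀I (Eq-refl τ (wkT s · v0))
  Eq-refl (σ *)   s = ∧I (ω (≐-refl _)) (∀<I (⊃I (Eq-refl σ (nth · wkT s · v0))))

  Eq-sym : (τ : Ty) (s t : Tm 𝒦 Γ τ) → H ⊩ Eq τ s t ⊃ Eq τ t s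
  Eq-sym 𝟎       s t = ω (≐-sym s t)
  Eq-sym (σ ⇒ τ) s t =
    ⊃I (∀I (⊃E (Eq-sym τ (wkT s · v0) (wkT t · v0)) (∀E-v0 #0)))
  Eq-sym (σ *)   s t =
    ⊃I (∧I (≐sym (∧E₁ #0))
           (∀<I (⊃I (⊃E (Eq-sym σ (nth · wkT s · v0) (nth · wkT t · v0))
                        -- The bound is now `len · t`; equality of the lengths brings the index
                        -- below `len · s`.
                        (∀<E-v0 (∧E₂ #1) (<-respʳ (≐sym (∧E₁ #1)) #0))))))

  Eq-trans : (τ : Ty) (s t u : Tm 𝒦 Γ τ) → H ⊩ Eq τ s t ⊃ Eq τ t u ⊃ Eq τ s u
  Eq-trans 𝟎       s t u = ω (≐-trans s t u)
  Eq-trans (σ ⇒ τ) s t u =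
    ⊃I (⊃I (∀I (⊃E (⊃E (Eq-trans τ (wkT s · v0) (wkT t · v0) (wkT u · v0))
                       (∀E-v0 #1)) (∀E-v0 #0))))
  Eq-trans (σ *)   s t u =
    ⊃I (⊃I (∧I (≐trans (∧E₁ #1) (∧E₁ #0))
      (∀<I (⊃I (⊃E (⊃E (Eq-trans σ (nth · wkT s · v0) (nth · wkT t · v0)
                                   (nth · wkT u · v0))
                       (∀<E-v0 (∧E₂ #2) #0))
                   (∀<E-v0 (∧E₂ #1) (<-respʳ (∧E₁ #2) #0)))))))

  -- `Eq τ s t` does not determine its arguments by unification; this does.
  infix 4 _⊩_≋_
  record _⊩_≋_ (H : List (Form 𝒦 Γ)) (s t : Tm 𝒦 Γ τ) : Set where
    constructor ⟪_⟫
    field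
      eq : H ⊩ Eq τ s t

  open _⊩_≋_ public

  private
    variable
      s t u : Tm 𝒦 Γ τ

  ≋refl : H ⊩ s ≋ s
  ≋refl {s = s} = ⟪ Eq-refl _ s ⟫

  ≋reflexive : s ≡ t → H ⊩ s ≋ t
  ≋reflexive refl = ≋refl

  ≋sym : H ⊩ s ≋ t → H ⊩ t ≋ s
  ≋sym {s = s} {t = t} ⟪ d ⟫ = ⟪ ⊃E (Eq-sym _ s t) d ⟫

  infixr 6 _⨟_
  _⨟_ : H ⊩ s ≋ t → H ⊩ t ≋ u → H ⊩ s ≋ u
  _⨟_ {s = s} {t = t} {u = u} ⟪ d ⟫ ⟪ e ⟫ = ⟪ ⊃E (⊃E (Eq-trans _ s t u) d) e ⟫

  infixl 7 _⊙_
  -- The function is exchanged by pointwise equality, the argument by the extensionality axiom.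
  _⊙_ : {s t : Tm 𝒦 Γ (σ ⇒ τ)} {u v : Tm 𝒦 Γ σ} →
        H ⊩ s ≋ t → H ⊩ u ≋ v → H ⊩ s · u ≋ t · v
  _⊙_ {s = s} {t = t} {u = u} {v = v} ⟪ d ⟫ ⟪ e ⟫ =
    ⟪ Eq-fun s t d u ⟫ ⨟ ⟪ Eq-arg t u v e ⟫

  ≋⊩ : H ⊩ m ≋ n → H ⊩ n ≐ k → H ⊩ m ≐ k
  ≋⊩ d e = ≐trans (eq d) e

  𝐊-β : {x : Tm 𝒦 Γ σ} {y : Tm 𝒦 Γ τ} → H ⊩ 𝐊 · x · y ≋ x
  𝐊-β = ⟪ ω (𝐊-def _ _) ⟫

  𝐒-β : {x : Tm 𝒦 Γ (ρ ⇒ σ ⇒ τ)} {y : Tm 𝒦 Γ (ρ ⇒ σ)} {z : Tm 𝒦 Γ ρ} →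
        H ⊩ 𝐒 · x · y · z ≋ x · z · (y · z)
  𝐒-β = ⟪ ω (𝐒-def _ _ _) ⟫

  -- The substitution is carried along because bracket abstraction does not commute with it
  -- syntactically: a variable replaced by a compound term would be abstracted by `𝐒` instead of
  -- `𝐊`. Nested abstractions need this form.
  β-sub : (s : Sub 𝒦 Γ Δ) (t : Tm 𝒦 (σ ∷ Γ) τ) (u : Tm 𝒦 Δ σ) →
          H ⊩ subT s (ƛ t) · u ≋ subT (ext s u) t
  β-sub s (var (here refl)) u = 𝐒-β ⨟ 𝐊-β
  β-sub s (var (there i)) u = 𝐊-β
  β-sub s (con c) u = 𝐊-β
  β-sub s (t · t′) u = 𝐒-β ⨟ β-sub s t u ⊙ β-sub s t′ u
  β-sub s O u = 𝐊-β
  β-sub s S u = 𝐊-β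
  β-sub s 𝐊 u = 𝐊-β
  β-sub s 𝐒 u = 𝐊-β
  β-sub s R₀ u = 𝐊-β
  β-sub s nil u = 𝐊-β
  β-sub s cons u = 𝐊-β
  β-sub s len u = 𝐊-β
  β-sub s nth u = 𝐊-β
  β-sub s init u = 𝐊-β

  β₁ : (t : Tm 𝒦 (σ ∷ Γ) τ) (a : Tm 𝒦 Γ σ) → H ⊩ ƛ t · a ≋ subT (ext var a) t
  β₁ {H = H} t a = subst (λ f → H ⊩ f · a ≋ subT (ext var a) t)
    (subT-id (λ _ → refl) (ƛ t)) (β-sub var t a)

  β₂ : (t : Tm 𝒦 (σ ∷ ρ ∷ Γ) τ) (a : Tm 𝒦 Γ ρ) (b : Tm 𝒦 Γ σ) →
       H ⊩ ƛ (ƛ t) · a · b ≋ subT (ext (ext var a) b) t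
  β₂ t a b = β₁ (ƛ t) a ⊙ ≋refl ⨟ β-sub (ext var a) t b

-- Functionals for case distinction, search and coding

cond : Tm 𝒦 Γ 𝟎 → Tm 𝒦 Γ 𝟎 → Tm 𝒦 Γ 𝟎 → Tm 𝒦 Γ 𝟎
cond z a b = R₀ · z · a · (𝐊 · (𝐊 · b))

sg s̄g : Tm 𝒦 Γ 𝟎 → Tm 𝒦 Γ 𝟎
sg t = cond t O (S · O)
s̄g t = cond t (S · O) O

-- Closed functionals are written point-free: bracket abstraction triples the
-- size of a term, so nested uses of `ƛ` make conversion checking infeasible.
infixr 24 _∘ᵗ_
_∘ᵗ_ : Tm 𝒦 Γ (σ ⇒ τ) → Tm 𝒦 Γ (ρ ⇒ σ) → Tm 𝒦 Γ (ρ ⇒ τ)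
f ∘ᵗ g = 𝐒 · (𝐊 · f) · g

infixl 23 _at_
_at_ : Tm 𝒦 Γ (ρ ⇒ σ ⇒ τ) → Tm 𝒦 Γ σ → Tm 𝒦 Γ (ρ ⇒ τ)
f at y = 𝐒 · f · (𝐊 · y)

-- cond[ a , b ] · z = cond z a b
cond[_,_] : Tm 𝒦 Γ 𝟎 → Tm 𝒦 Γ 𝟎 → Tm 𝒦 Γ 𝟏
cond[ a , b ] = R₀ at a at 𝐊 · (𝐊 · b)

-- branch · (R₀ · z · a) · b = cond z a b
branch : Tm 𝒦 Γ (((𝟎 ⇒ 𝟎 ⇒ 𝟎) ⇒ 𝟎) ⇒ 𝟎 ⇒ 𝟎)
branch = 𝐒 ∘ᵗ 𝐊 at 𝐊 ∘ᵗ 𝐊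

-- find-step · h · r · i = cond (h · r) r i
find-step : Tm 𝒦 Γ (𝟏 ⇒ 𝟎 ⇒ 𝟎 ⇒ 𝟎)
find-step = 𝐒 ∘ᵗ 𝐒 · (𝐊 · (𝐒 · (𝐊 · branch) ∘ᵗ R₀)) at 𝐒 · 𝐊 · 𝐊 {τ = 𝟎}

-- A zero of h below p, if there is one.  Being a term in h and p, it is standard
-- when they are.
find : Tm 𝒦 Γ 𝟏 → Tm 𝒦 Γ 𝟎 → Tm 𝒦 Γ 𝟎
find h p = R₀ · p · O · (find-step · h)

-- Its zeros are the p with a zero of h up to p, so that Σ⁰₁ (spread h) n
-- holds, for every n, iff h has a zero.
spread : Tm 𝒦 Γ 𝟏 → Tm 𝒦 Γ 𝟏
spread h = cond[ O , S · O ] ∘ᵗ h ∘ᵗ (R₀ at O at find-step · h) ∘ᵗ S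

-- Its zeros are the arguments at which `h` does not vanish.
complement : Tm 𝒦 Γ 𝟏 → Tm 𝒦 Γ 𝟏
complement h = cond[ S · O , O ] ∘ᵗ h

+-step : Tm 𝒦 Γ (𝟎 ⇒ 𝟎 ⇒ 𝟎)
+-step = ƛ (ƛ (S · v1))

△-step : Tm 𝒦 Γ (𝟎 ⇒ 𝟎 ⇒ 𝟎)
△-step = ƛ (ƛ (v1 +ᵗ S · v0))

-- add · n · m = m +ᵗ n
add : Tm 𝒦 Γ (𝟎 ⇒ 𝟎 ⇒ 𝟎)
add = 𝐒 ∘ᵗ R₀ at 𝐊 · +-step

-- pair · n · m = ⟨ m , n ⟩
pair : Tm 𝒦 Γ (𝟎 ⇒ 𝟎 ⇒ 𝟎)
pair = 𝐒 ∘ᵗ (𝐒 · R₀ ∘ᵗ 𝐒 · (𝐊 · (R₀ at O at △-step)) ∘ᵗ add) at 𝐊 · +-step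

-- section · f · n · m = f · ⟨ m , n ⟩
section : Tm 𝒦 Γ (𝟏 ⇒ 𝟎 ⇒ 𝟏)
section = 𝐒 ∘ᵗ 𝐊 ∘ᵗ 𝐒 ∘ᵗ 𝐊 at pair

-- indicator φ · f is the characteristic function of { n ∣ Σ⁰₁ f n }, if φ
-- decides the existence of zeros.
indicator : Tm 𝒦 Γ 𝟐 → Tm 𝒦 Γ (𝟏 ⇒ 𝟏)
indicator φ = 𝐒 · (𝐊 · cond[ S · O , O ]) ∘ᵗ 𝐒 · (𝐊 · φ) ∘ᵗ section

-- image Φ · g · i = g · (nth · (Φ · g) · i)
image : Tm 𝒦 Γ (𝟏 ⇒ 𝟎 *) → Tm 𝒦 Γ (𝟏 ⇒ 𝟏)
image Φ = 𝐒 · (𝐒 ∘ᵗ 𝐊) · (nth ∘ᵗ Φ)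

-- Zero if g has a zero in the list Φ · g.  The converse may fail, as nth takes
-- junk values on the empty list, but a zero of g exists in any case.
hit : Tm 𝒦 Γ (𝟏 ⇒ 𝟎 *) → Tm 𝒦 Γ 𝟐
hit Φ = cond[ O , S · O ] ∘ᵗ
        𝐒 · image Φ · (𝐒 · (R₀ ∘ᵗ len ∘ᵗ Φ at O) · (find-step ∘ᵗ image Φ))

-- Zero at the n with Σ⁰₁ f n and Σ⁰₁ g n, if φ decides the existence of zeros.
common : Tm 𝒦 Γ 𝟐 → Tm 𝒦 Γ 𝟏 → Tm 𝒦 Γ 𝟏 → Tm 𝒦 Γ 𝟏
common φ f g =
  𝐒 · (R₀ ∘ᵗ φ ∘ᵗ section · f) · (φ ∘ᵗ section · g) at 𝐊 · (𝐊 · (S · O))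

-- Zero exactly at 1: brings a test for the value 1 into the form required by `Decides`.
unit-test : Tm 𝒦 Γ 𝟎 → Tm 𝒦 Γ 𝟎
unit-test t = cond t (S · O) (pred t)

HasZero : Tm 𝒦 Γ 𝟏 → Form 𝒦 Γ
HasZero g = ∃[ 𝟎 ] wkT g · v0 ≐ O

Decides : Tm 𝒦 Γ 𝟐 → Form 𝒦 Γ
Decides φ = ∀[ 𝟏 ] (HasZero v0 ⇔ wkT φ · v0 ≐ O)

ZeroFinder : Tm 𝒦 Γ 𝟐 → Form 𝒦 Γ
ZeroFinder μ = ∀[ 𝟏 ] (HasZero v0 ⊃ v0 · (wkT μ · v0) ≐ O)

-- What `HACint` yields for the relation "if `g` has a zero, then `n` is one".
Selects : Tm 𝒦 Γ (𝟏 ⇒ 𝟎 *) → Form 𝒦 Γ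
Selects Φ = ∀ˢᵗ[ 𝟏 ] ∃∈[ wkT Φ · v0 ] (HasZero v1 ⊃ v1 · v0 ≐ O)

-- Elementary arithmetic and bounded search

module Arithmetic {𝒦 : Sig} (T : Theory 𝒦)
                  (base : ∀ {Γ} {A : Form 𝒦 Γ} → RCA₀ω A → T A) where
  open Logic T public
  open Equality T base public

  private
    variable
      a b c m n p z : Tm 𝒦 Γ 𝟎
      h : Tm 𝒦 Γ 𝟏

  induction : (A : Form 𝒦 (𝟎 ∷ Γ)) → QF A → H ⊩ A [ O ] →
              A ∷ map wk H ⊩ sub succ-inst A → H ⊩ ∀[ 𝟎 ] A
  induction A qf d e = ⊃E (ω (QF-induction A qf)) (∧I d (∀I (⊃I e)))

  S≢O : H ⊩ n ≐ S · m → H ⊩ n ≐ O → H ⊩ falsum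
  S≢O d e = ⊃E (ω (S-nonzero _)) (≐trans (≐sym d) e)

  S-inj : H ⊩ S · m ≐ S · n → H ⊩ m ≐ n
  S-inj = ⊃E (ω (S-injective _ _))

  R₀-O-β : {f : Tm 𝒦 Γ (𝟎 ⇒ 𝟎 ⇒ 𝟎)} → H ⊩ R₀ · O · a · f ≋ a
  R₀-O-β = ⟪ ω (R₀-O _ _) ⟫

  R₀-S-β : {f : Tm 𝒦 Γ (𝟎 ⇒ 𝟎 ⇒ 𝟎)} →
           H ⊩ R₀ · (S · n) · a · f ≋ f · (R₀ · n · a · f) · n
  R₀-S-β = ⟪ ω (R₀-S _ _ _) ⟫

  pred-S : H ⊩ pred (S · n) ≋ n
  pred-S = R₀-S-β ⨟ β₂ v0 _ _

  zero-or-pred : (n : Tm 𝒦 Γ 𝟎) → H ⊩ n ≐ O ∨ n ≐ S · pred n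
  zero-or-pred = ∀E (induction (v0 ≐ O ∨ v0 ≐ S · pred v0) _
    (∨I₁ (eq ≋refl)) (∨I₂ (eq (≋refl ⊙ ≋sym pred-S))))

  nonzero-pred : H ⊩ ¬ᶠ (n ≐ O) → H ⊩ n ≐ S · pred n
  nonzero-pred d = ∨E (zero-or-pred _) (ex-falso (⊃E (↑ d) #0)) #0

  cond-O : H ⊩ z ≐ O → H ⊩ cond z a b ≋ a
  cond-O d = ≋refl ⊙ ⟪ d ⟫ ⊙ ≋refl ⊙ ≋refl ⨟ R₀-O-β

  cond-nonzero : H ⊩ ¬ᶠ (z ≐ O) → H ⊩ cond z a b ≋ b
  cond-nonzero d =
    ≋refl ⊙ ⟪ nonzero-pred d ⟫ ⊙ ≋refl ⊙ ≋refl ⨟ R₀-S-β ⨟ 𝐊-β ⊙ ≋refl ⨟ 𝐊-β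

  sg-O⁻¹ : H ⊩ sg z ≐ O → H ⊩ z ≐ O
  sg-O⁻¹ d = raa (S≢O (eq (cond-nonzero #0)) (↑ d))

  s̄g-O⁻¹ : H ⊩ s̄g z ≐ O → H ⊩ ¬ᶠ (z ≐ O)
  s̄g-O⁻¹ d = ⊃I (S≢O (eq (cond-O #0)) (↑ d))

  sg-bit : (z : Tm 𝒦 Γ 𝟎) → H ⊩ sg z ≐ O ∨ sg z ≐ S · O
  sg-bit z = by-cases (z ≐ O) (∨I₁ (eq (cond-O #0))) (∨I₂ (eq (cond-nonzero #0)))

  s̄g-bit : (z : Tm 𝒦 Γ 𝟎) → H ⊩ s̄g z ≐ O ∨ s̄g z ≐ S · O
  s̄g-bit z = by-cases (z ≐ O) (∨I₂ (eq (cond-O #0))) (∨I₁ (eq (cond-nonzero #0)))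

  +-S : H ⊩ m +ᵗ S · n ≋ S · (m +ᵗ n)
  +-S = R₀-S-β ⨟ β₂ (S · v1) _ _

  +-congˡ : H ⊩ m ≋ n → H ⊩ m +ᵗ p ≋ n +ᵗ p
  +-congˡ d = ≋refl ⊙ d ⊙ ≋refl

  O-+ : (n : Tm 𝒦 Γ 𝟎) → H ⊩ O +ᵗ n ≋ n
  O-+ n = ⟪ ∀E (induction (O +ᵗ v0 ≐ v0) _ (eq R₀-O-β) (eq (+-S ⨟ ≋refl ⊙ ⟪ #0 ⟫))) n ⟫

  -- Addition recurs on its second argument, hence the induction. The parameter is first generalised
  -- to a variable, on which substitution computes.
  S-+ : (m n : Tm 𝒦 Γ 𝟎) → H ⊩ S · m +ᵗ n ≋ S · (m +ᵗ n)
  S-+ m n = ⟪ ∀E₂ (∀I (induction (S · v1 +ᵗ v0 ≐ S · (v1 +ᵗ v0)) _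
    (eq (R₀-O-β ⨟ ≋refl ⊙ ≋sym R₀-O-β))
    (eq (+-S ⨟ ≋refl ⊙ (⟪ #0 ⟫ ⨟ ≋sym +-S))))) m n ⟫

  ∸-S : H ⊩ m ∸ᵗ S · n ≋ pred (m ∸ᵗ n)
  ∸-S = R₀-S-β ⨟ β₂ (pred v1) _ _

  find-cong : H ⊩ m ≋ n → H ⊩ find h m ≋ find h n
  find-cong d = ≋refl ⊙ d ⊙ ≋refl ⊙ ≋refl

  at-β : {f : Tm 𝒦 Γ (ρ ⇒ σ ⇒ τ)} {y : Tm 𝒦 Γ σ} {x : Tm 𝒦 Γ ρ} →
         H ⊩ (f at y) · x ≋ f · x · y
  at-β = 𝐒-β ⨟ ≋refl ⊙ 𝐊-β

  ∘-β : {f : Tm 𝒦 Γ (σ ⇒ τ)} {g : Tm 𝒦 Γ (ρ ⇒ σ)} {x : Tm 𝒦 Γ ρ} →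
        H ⊩ (f ∘ᵗ g) · x ≋ f · (g · x)
  ∘-β = 𝐒-β ⨟ 𝐊-β ⊙ ≋refl

  cond[]-β : H ⊩ cond[ a , b ] · z ≋ cond z a b
  cond[]-β = at-β ⨟ at-β ⊙ ≋refl

  branch-β : H ⊩ branch · (R₀ · z · a) · b ≋ cond z a b
  branch-β = (at-β ⨟ ∘-β ⊙ ≋refl) ⊙ ≋refl ⨟ ∘-β ⨟ ≋refl ⊙ ∘-β

  find-step-β : H ⊩ find-step · h · m · n ≋ cond (h · m) m n
  find-step-β =
    ((at-β ⨟ ∘-β ⊙ ≋refl) ⊙ ≋refl ⨟
     𝐒-β ⨟ (∘-β ⨟ ∘-β) ⊙ (𝐒-β ⨟ 𝐊-β) ⨟ ∘-β) ⊙ ≋refl ⨟ branch-β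

  find-S : H ⊩ find h (S · p) ≋ cond (h · find h p) (find h p) p
  find-S = R₀-S-β ⨟ find-step-β

  find-keep : H ⊩ h · find h p ≐ O → H ⊩ h · find h (S · p) ≐ O
  find-keep d = ≋⊩ (≋refl ⊙ (find-S ⨟ cond-O d)) d

  -- Either the candidate found so far is already a zero and is kept, or `p` replaces it.
  find-hit : H ⊩ h · p ≐ O → H ⊩ h · find h (S · p) ≐ O
  find-hit d = by-cases _ (find-keep #0)
    (≋⊩ (≋refl ⊙ (find-S ⨟ cond-nonzero #0)) (↑ d))

  find-+ : (p : Tm 𝒦 Γ 𝟎) → H ⊩ h · find h n ≐ O → H ⊩ h · find h (p +ᵗ n) ≐ O
  find-+ {h = h} {n = n} p = ⊃E (∀E₃ (∀I (∀I (induction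
    (v2 · find v2 v1 ≐ O ⊃ v2 · find v2 (v0 +ᵗ v1) ≐ O) _
    (⊃I (≋⊩ (≋refl ⊙ find-cong (O-+ _)) #0))
    (⊃I (≋⊩ (≋refl ⊙ find-cong (S-+ _ _)) (find-keep (⊃E #1 #0))))))) h n p)

  -- Truncated subtraction is tamed by carrying (i + 1 ∸ p) + p = i + 1 along
  -- until p reaches i.
  find-< : H ⊩ h · n ≐ O → H ⊩ n <ᶠ p → H ⊩ h · find h p ≐ O
  find-< {h = h} {n = n} {p = p} d e =
    ∨E (⊃E (∀E₃ (∀I (∀I (induction
         (v2 · v1 ≐ O ⊃ v2 · find v2 v0 ≐ O ∨
           ¬ᶠ (S · v1 ∸ᵗ v0 ≐ O) ∧ ((S · v1 ∸ᵗ v0) +ᵗ v0 ≐ S · v1)) _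
         (⊃I (∨I₂ (∧I (⊃I (S≢O (eq R₀-O-β) #0)) (eq (R₀-O-β ⨟ R₀-O-β)))))
         (⊃I (∨E (⊃E #1 #0) (∨I₁ (find-keep #0)) step))))) h n p) d)
       #0
       (ex-falso (⊃E (∧E₁ #0) (↑ e)))
    where
    step : ∀ {i p : Tm 𝒦 Γ 𝟎} {h B} →
           let D = λ q → S · i ∸ᵗ q in
           (¬ᶠ (D p ≐ O) ∧ (D p +ᵗ p ≐ S · i)) ∷ h · i ≐ O ∷ B ∷ H ⊩
           h · find h (S · p) ≐ O ∨ ¬ᶠ (D (S · p) ≐ O) ∧ (D (S · p) +ᵗ S · p ≐ S · i)
    step {i = i} {p = p} {h = h} = by-cases (S · i ∸ᵗ S · p ≐ O)
      -- If the new difference vanishes, the carried sum reads `O +ᵗ S · p ≐ S · i`, so `p` is the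
      -- zero `i`.
      (∨I₁ (find-hit (≋⊩
        (≋refl ⊙ ⟪ S-inj (eq (≋sym (+-congˡ ⟪ #0 ⟫ ⨟ O-+ _) ⨟ ⟪ ↑ sum ⟫)) ⟫) #2)))
      (∨I₂ (∧I #0 (↑ sum)))
      where
      -- The difference is not zero at `p`, so the successor gained by `p` is the one that `pred`
      -- removes.
      sum = eq (+-congˡ ∸-S ⨟ +-S ⨟ ≋sym (S-+ _ _) ⨟
                +-congˡ (≋sym ⟪ nonzero-pred (∧E₁ #0) ⟫) ⨟ ⟪ ∧E₂ #0 ⟫)

  spread-β : H ⊩ spread h · p ≋ sg (h · find h (S · p))
  spread-β = ∘-β ⨟ cond[]-β ⨟
    ≋refl ⊙ (∘-β ⨟ ≋refl ⊙ (∘-β ⨟ at-β ⨟ at-β ⊙ ≋refl)) ⊙ ≋refl ⊙ ≋refl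

  spread-O⁻¹ : H ⊩ spread h · p ≐ O → H ⊩ h · find h (S · p) ≐ O
  spread-O⁻¹ d = sg-O⁻¹ (≋⊩ (≋sym spread-β) d)

  -- Cantor's code ends in `+ᵗ m`, so `S · ⟨ m , n ⟩` is a number plus `S · m`, and the zero found
  -- below `S · m` is kept up to there.
  spread-O : H ⊩ h · m ≐ O → H ⊩ spread h · ⟨ m , n ⟩ ≐ O
  spread-O d = eq (spread-β ⨟
    cond-O (≋⊩ (≋refl ⊙ find-cong (≋sym +-S)) (find-+ _ (find-hit d))))

  complement-β : H ⊩ complement h · n ≋ s̄g (h · n)
  complement-β = ∘-β ⨟ cond[]-β

  -- Coding of pairs and decision of Σ⁰₁ formulas

  add-β : H ⊩ add · n · m ≋ m +ᵗ n
  add-β = (at-β ⨟ ∘-β ⊙ ≋refl) ⊙ ≋refl ⨟ at-β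

  pair-β : H ⊩ pair · n · m ≋ ⟨ m , n ⟩
  pair-β =
    (at-β ⨟ (∘-β ⨟ ≋refl ⊙ (∘-β ⨟ ≋refl ⊙ ∘-β)) ⊙ ≋refl) ⊙ ≋refl ⨟ at-β ⨟
    (𝐒-β ⨟ ≋refl ⊙ (∘-β ⨟ (at-β ⨟ at-β ⊙ ≋refl) ⨟ ≋refl ⊙ add-β ⊙ ≋refl ⊙ ≋refl)) ⊙ ≋refl

  section-β : {f : Tm 𝒦 Γ 𝟏} → H ⊩ section · f · n · m ≋ f · ⟨ m , n ⟩
  section-β =
    ((at-β ⨟ (∘-β ⨟ ≋refl ⊙ (∘-β ⨟ ≋refl ⊙ ∘-β)) ⊙ ≋refl) ⊙ ≋refl ⨟ ∘-β) ⊙ ≋refl ⨟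
    ∘-β ⨟ ≋refl ⊙ pair-β

  section-zero : {f : Tm 𝒦 Γ 𝟏} → H ⊩ Σ⁰₁ f n → H ⊩ HasZero (section · f · n)
  section-zero d = ∃-map d (≋⊩ section-β #0)

  section-zero⁻¹ : {f : Tm 𝒦 Γ 𝟏} → H ⊩ HasZero (section · f · n) → H ⊩ Σ⁰₁ f n
  section-zero⁻¹ d = ∃-map d (≋⊩ (≋sym section-β) #0)

  decide : {φ : Tm 𝒦 Γ 𝟐} → H ⊩ Decides φ → (g : Tm 𝒦 Γ 𝟏) →
           H ⊩ HasZero g ⇔ φ · g ≐ O
  decide {H = H} {φ = φ} d g =
    subst (λ t → H ⊩ HasZero g ⇔ t · g ≐ O) (subT-inst-wkT g φ) (∀E d g)

  indicator-β : {φ : Tm 𝒦 Γ 𝟐} {f : Tm 𝒦 Γ 𝟏} →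
                H ⊩ indicator φ · f · n ≋ s̄g (φ · (section · f · n))
  indicator-β = (∘-β ⨟ ≋refl ⊙ ∘-β) ⊙ ≋refl ⨟ ∘-β ⨟ cond[]-β ⨟
    ≋refl ⊙ ∘-β ⊙ ≋refl ⊙ ≋refl

  indicator-∈ : {φ : Tm 𝒦 Γ 𝟐} {f : Tm 𝒦 Γ 𝟏} →
                H ⊩ Decides φ → H ⊩ Σ⁰₁ f n → H ⊩ indicator φ · f · n ≐ S · O
  indicator-∈ d e =
    eq (indicator-β ⨟ cond-O (⊃E (∧E₁ (decide d _)) (section-zero e)))

  indicator-∉ : {φ : Tm 𝒦 Γ 𝟐} {f : Tm 𝒦 Γ 𝟏} →
                H ⊩ Decides φ → H ⊩ ¬ᶠ Σ⁰₁ f n → H ⊩ indicator φ · f · n ≐ O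
  indicator-∉ d e = eq (indicator-β ⨟ cond-nonzero
    (⊃I (⊃E (↑ e) (section-zero⁻¹ (⊃E (∧E₂ (decide (↑ d) _)) #0)))))

  indicator-isSet : {φ : Tm 𝒦 Γ 𝟐} {f : Tm 𝒦 Γ 𝟏} → H ⊩ IsSet (indicator φ · f)
  indicator-isSet = ∀I (∨E (s̄g-bit _)
    (∨I₁ (≋⊩ indicator-β #0)) (∨I₂ (≋⊩ indicator-β #0)))

  common-β : {φ : Tm 𝒦 Γ 𝟐} {f g : Tm 𝒦 Γ 𝟏} → H ⊩ common φ f g · n ≋
              cond (φ · (section · f · n)) (φ · (section · g · n)) (S · O)
  common-β = at-β ⨟ (𝐒-β ⨟ (∘-β ⨟ ≋refl ⊙ ∘-β) ⊙ ∘-β) ⊙ ≋refl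

  common-O : {φ : Tm 𝒦 Γ 𝟐} {f g : Tm 𝒦 Γ 𝟏} → H ⊩ Decides φ →
              H ⊩ Σ⁰₁ f n ∧ Σ⁰₁ g n → H ⊩ common φ f g · n ≐ O
  common-O d e = eq (common-β ⨟
    cond-O (⊃E (∧E₁ (decide d _)) (section-zero (∧E₁ e))) ⨟
    ⟪ ⊃E (∧E₁ (decide d _)) (section-zero (∧E₂ e)) ⟫)

  common-O⁻¹ : {φ : Tm 𝒦 Γ 𝟐} {f g : Tm 𝒦 Γ 𝟏} → H ⊩ Decides φ →
                H ⊩ common φ f g · n ≐ O → H ⊩ Σ⁰₁ f n ∧ Σ⁰₁ g n
  common-O⁻¹ d e = ∧I
    (section-zero⁻¹ (⊃E (∧E₂ (decide d _)) first))
    (section-zero⁻¹ (⊃E (∧E₂ (decide d _))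
      (≋⊩ (≋sym (common-β ⨟ cond-O first)) e)))
    where
    -- Otherwise `common` takes its default value 1.
    first = raa (S≢O (eq (common-β ⨟ cond-nonzero #0)) (↑ e))

  -- Uniform separation and (∃²)

  ∃²⇒UΣ⁰₁-SEP : H ⊩ ∃² → H ⊩ UΣ⁰₁-SEP
  -- The separating set is the extension of φ₁ itself; `𝐊` discards `g`, and disjointness gives the
  -- value 0 where φ₂ holds.
  ∃²⇒UΣ⁰₁-SEP d = ∃E d (∃I (𝐊 ∘ᵗ indicator v0) (∀I (∀I (⊃I (∧I
    (∀I (⊃I (≋⊩ (β ⊙ ≋refl) (indicator-∈ (hyp (there (there (here refl)))) #0))))
    (∀I (⊃I (≋⊩ (β ⊙ ≋refl) (indicator-∉ (hyp (there (there (here refl))))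
                   (⊃I (⊃E (∀E #2 v0) (∧I #0 #1))))))))))))
    where
    β : {F : Tm 𝒦 Γ (𝟏 ⇒ 𝟏)} {f g : Tm 𝒦 Γ 𝟏} → H ⊩ (𝐊 ∘ᵗ F) · f · g ≋ F · f
    β = ∘-β ⊙ ≋refl ⨟ 𝐊-β

  unit-test-O : H ⊩ n ≐ S · O → H ⊩ unit-test n ≐ O
  unit-test-O d = eq (cond-nonzero (⊃I (S≢O (↑ d) #0)) ⨟
    ≋refl ⊙ ⟪ d ⟫ ⊙ ≋refl ⊙ ≋refl ⨟ pred-S)

  unit-test-O⁻¹ : H ⊩ unit-test n ≐ O → H ⊩ n ≐ S · O
  unit-test-O⁻¹ d = by-cases _
    (ex-falso (S≢O (eq (cond-O #0)) (↑ d)))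
    (eq (⟪ nonzero-pred #0 ⟫ ⨟ ≋refl ⊙ (≋sym (cond-nonzero #0) ⨟ ⟪ ↑ d ⟫)))

  one : Tm 𝒦 Γ 𝟏
  one = 𝐊 · (S · O)

  -- Whatever number the search returns, `h` does not vanish there. Extensionality is applied to
  -- this equality in Grilliot's trick.
  spread-one : {h : Tm 𝒦 Γ 𝟏} → H ⊩ ¬ᶠ HasZero h → H ⊩ spread h ≋ one
  spread-one {Γ = Γ} {H = H} {h = h} d = ⟪ ⊃E (∀E lemma h) d ⟫
    where
    lemma : H ⊩ ∀[ 𝟏 ] (¬ᶠ HasZero v0 ⊃ Eq 𝟏 (spread v0) one)
    lemma = ∀I (⊃I (∀I (eq (spread-β ⨟
      cond-nonzero (⊃I (⊃E #1 (∃I _ #0))) ⨟ ≋sym 𝐊-β))))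

  -- Makes the disjointness premise of separation vacuous when one of the two functions is `one`.
  no-Σ⁰₁-one : H ⊩ ¬ᶠ Σ⁰₁ one n
  no-Σ⁰₁-one = ⊃I (∃E #0 (S≢O (eq 𝐊-β) #0))

  -- `QF-AC¹⁰` applied to the graph of `t` yields the functional without bracket abstraction of `t`.
  graph⇒∃² : {t : Tm 𝒦 (𝟏 ∷ Γ) 𝟎} →
             H ⊩ ∀[ 𝟏 ] (HasZero v0 ⇔ t ≐ O) → H ⊩ ∃[ 𝟐 ] Decides v0
  graph⇒∃² {Γ = Γ} {t = t} d = cut d (∃E
    (⊃E (ω (QF-AC¹⁰ (wkT t ≐ v0) tt))
        (∀I (∃I t (eq (≋reflexive (subT-inst-wkT t t))))))
    (∃I v0 (∀I (∧I
      (⊃I (≋⊩ (≋sym graph) (⊃E (∧E₁ (iff #2)) #0)))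
      (⊃I (⊃E (∧E₂ (iff #2)) (≋⊩ graph #0)))))))
    where
    t′ : Tm 𝒦 (𝟏 ∷ 𝟐 ∷ Γ) 𝟎
    t′ = renT (liftR there) t

    iff : H ⊩ wk (∀[ 𝟏 ] (HasZero v0 ⇔ t′ ≐ O)) → H ⊩ HasZero v0 ⇔ t′ ≐ O
    iff = ∀E-v0

    graph : A ∷ wk (∀[ 𝟏 ] sub choice-inst (wkT t ≐ v0)) ∷ H ⊩ t′ ≋ v1 · v0
    graph = ≋reflexive
      (trans (renT≡subT (λ { (here refl) → refl ; (there i) → refl }) t)
             (sym (subT-wkT t)))
      ⨟ ⟪ ∀E-v0 {A = sub choice-inst (wkT t ≐ v0)} #1 ⟫

  -- Grilliot's trick: F (one , one) 0 cannot be both 0 and 1, while a zero of h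
  -- forces F (one , spread h) 0 = 0 and F (spread h , one) 0 = 1; by
  -- extensionality one of these two values detects the zeros of h.
  UΣ⁰₁-SEP⇒∃² : H ⊩ UΣ⁰₁-SEP → H ⊩ ∃²
  UΣ⁰₁-SEP⇒∃² d = ∃E d (by-cases (v0 · one · one · O ≐ S · O)
    (graph⇒∃² {t = v1 · one · spread v0 · O} (∀I (∧I
      (⊃I (⊃E (∀E (∧E₂ (⊃E (∀E₂ #2 one (spread v0))
                           (∀I (⊃I (⊃E no-Σ⁰₁-one (∧E₁ #0)))))) O)
              (∃-map #0 (spread-O #0))))
      (⊃I (raa (S≢O
        (eq (≋refl ⊙ spread-one #0 ⊙ ≋refl ⨟ ⟪ #2 ⟫)) #1))))))
    (graph⇒∃² {t = unit-test (v1 · spread v0 · one · O)} (∀I (∧I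
      (⊃I (unit-test-O
        (⊃E (∀E (∧E₁ (⊃E (∀E₂ #2 (spread v0) one)
                         (∀I (⊃I (⊃E no-Σ⁰₁-one (∧E₂ #0)))))) O)
            (∃-map #0 (spread-O #0)))))
      (⊃I (raa (⊃E #2
        (eq (≋refl ⊙ ≋sym (spread-one #0) ⊙ ≋refl ⊙ ≋refl ⨟
             ⟪ unit-test-O⁻¹ #1 ⟫)))))))))

  -- The functional of (∃²) replaces "`g` has a zero" by an equation, which makes the matrix
  -- quantifier-free, as `QF-AC¹⁰` requires.
  ∃²⇒zero-finder : H ⊩ ∃² → H ⊩ ∃[ 𝟐 ] ZeroFinder v0
  ∃²⇒zero-finder d = ∃E d (∃E
    (⊃E (ω (QF-AC¹⁰ (v2 · v1 ≐ O ⊃ v1 · v0 ≐ O) _))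
        (∀I (by-cases (v1 · v0 ≐ O)
          (∃-map (⊃E (∧E₂ (decide {φ = v1} #1 v0)) #0) (⊃I #1))
          (∃I O (⊃I (ex-falso (⊃E #1 #0)))))))
    (∃I v0 (∀I (⊃I (⊃E (∀E #1 v0) (⊃E (∧E₁ (decide {φ = v2} #2 v0)) #0))))))

  -- Search through a list of candidates

  image-β : {Φ : Tm 𝒦 Γ (𝟏 ⇒ 𝟎 *)} → H ⊩ image Φ · h · n ≋ h · (nth · (Φ · h) · n)
  image-β = (𝐒-β ⨟ ∘-β ⊙ ∘-β) ⊙ ≋refl ⨟ ∘-β

  hit-β : {Φ : Tm 𝒦 Γ (𝟏 ⇒ 𝟎 *)} →
          H ⊩ hit Φ · h ≋ sg (image Φ · h · find (image Φ · h) (len · (Φ · h)))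
  hit-β = ∘-β ⨟ cond[]-β ⨟
    ≋refl ⊙ (𝐒-β ⨟ ≋refl ⊙ (𝐒-β ⨟
      (at-β ⨟ (∘-β ⨟ ≋refl ⊙ ∘-β) ⊙ ≋refl) ⊙ ∘-β)) ⊙ ≋refl ⊙ ≋refl

  hit-O : {Φ : Tm 𝒦 Γ (𝟏 ⇒ 𝟎 *)} → H ⊩ h · (nth · (Φ · h) · n) ≐ O →
          H ⊩ n <ᶠ len · (Φ · h) → H ⊩ hit Φ · h ≐ O
  hit-O d e = eq (hit-β ⨟ cond-O (find-< (≋⊩ image-β d) e))

  -- The zero is exhibited as a term in `Φ` and `h`, hence it is standard when they are; `agree`
  -- relies on this.
  hit-O⁻¹ : {Φ : Tm 𝒦 Γ (𝟏 ⇒ 𝟎 *)} → H ⊩ hit Φ · h ≐ O →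
            H ⊩ h · (nth · (Φ · h) · find (image Φ · h) (len · (Φ · h))) ≐ O
  hit-O⁻¹ d = ≋⊩ (≋sym image-β) (sg-O⁻¹ (≋⊩ (≋sym hit-β) d))

  hit-bit : {Φ : Tm 𝒦 Γ (𝟏 ⇒ 𝟎 *)} → H ⊩ hit Φ · h ≐ O ∨ hit Φ · h ≐ S · O
  hit-bit = ∨E (sg-bit _) (∨I₁ (≋⊩ hit-β #0)) (∨I₂ (≋⊩ hit-β #0))

  -- Membership in `Φ · h` unfolds to an index below its length, which is the bound of the search.
  selects-hit : {Φ : Tm 𝒦 Γ (𝟏 ⇒ 𝟎 *)} → H ⊩ Selects Φ → H ⊩ st h →
                H ⊩ HasZero h → H ⊩ hit Φ · h ≐ O
  selects-hit {Γ = Γ} {H = H} {h = h} {Φ = Φ} d e f =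
    ⊃E (⊃E (⊃E (∀E₂ lemma Φ h) d) e) f
    where
    lemma : H ⊩ ∀[ 𝟏 ⇒ 𝟎 * ] ∀[ 𝟏 ]
                  (Selects v1 ⊃ st v0 ⊃ HasZero v0 ⊃ hit v1 · v0 ≐ O)
    lemma = ∀I (∀I (⊃I (⊃I (⊃I (∃E (⊃E (∀E #2 v0) #1)
      (∃E (⊃E (∧E₁ (ω (∃<-def (len · (v2 · v1)) (v1 ≐ nth · (v3 · v2) · v0))))
              (∧E₁ #0))
        (hit-O (eq (≋refl ⊙ ≋sym ⟪ ∧E₂ #0 ⟫ ⨟ ⟪ ⊃E (∧E₂ #1) #2 ⟫))
               (∧E₁ #0))))))))

-- Standardness of terms and transfer of zeros

module Nonstandard (𝒮 : Specification) where
  open Specification 𝒮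
  open Arithmetic (RCA₀Ω 𝒮) base

  private
    variable
      m n : Tm Const Γ 𝟎
      f g h : Tm Const Γ 𝟏

  closed : (t : Tm Const [] τ) → H ⊩ st (renT from[] t)
  closed t = axiom (st-closed t)

  infixl 25 _·ˢ_
  _·ˢ_ : {s : Tm Const Γ (σ ⇒ τ)} {t : Tm Const Γ σ} →
         H ⊩ st s → H ⊩ st t → H ⊩ st (s · t)
  d ·ˢ e = ⊃E (⊃E (axiom (st-app _ _)) d) e

  infixr 24 _∘ˢ_
  _∘ˢ_ : {s : Tm Const Γ (σ ⇒ τ)} {t : Tm Const Γ (ρ ⇒ σ)} →
         H ⊩ st s → H ⊩ st t → H ⊩ st (s ∘ᵗ t)
  d ∘ˢ e = closed 𝐒 ·ˢ (closed 𝐊 ·ˢ d) ·ˢ e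

  infixl 23 _atˢ_
  _atˢ_ : {s : Tm Const Γ (ρ ⇒ σ ⇒ τ)} {t : Tm Const Γ σ} →
          H ⊩ st s → H ⊩ st t → H ⊩ st (s at t)
  d atˢ e = closed 𝐒 ·ˢ d ·ˢ (closed 𝐊 ·ˢ e)

  find-st : H ⊩ st h → H ⊩ st n → H ⊩ st (find h n)
  find-st d e = closed R₀ ·ˢ e ·ˢ closed O ·ˢ (closed find-step ·ˢ d)

  spread-st : H ⊩ st h → H ⊩ st (spread h)
  spread-st d = closed cond[ O , S · O ] ∘ˢ d ∘ˢ
    (closed (R₀ at O) atˢ closed find-step ·ˢ d) ∘ˢ closed S

  complement-st : H ⊩ st h → H ⊩ st (complement h)
  complement-st d = closed cond[ S · O , O ] ∘ˢ d

  +-st : H ⊩ st m → H ⊩ st n → H ⊩ st (m +ᵗ n)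
  +-st d e = closed R₀ ·ˢ e ·ˢ d ·ˢ closed +-step

  ⟨,⟩-st : H ⊩ st m → H ⊩ st n → H ⊩ st ⟨ m , n ⟩
  ⟨,⟩-st d e = +-st (closed R₀ ·ˢ +-st d e ·ˢ closed O ·ˢ closed △-step) d

  common-st : H ⊩ st f → H ⊩ st g → H ⊩ st (common (con E) f g)
  common-st d e =
    closed 𝐒 ·ˢ (closed R₀ ∘ˢ closed (con E) ∘ˢ closed section ·ˢ d) ·ˢ
    (closed (con E) ∘ˢ closed section ·ˢ e) atˢ closed (𝐊 · (𝐊 · (S · O)))

  image-st : {Φ : Tm Const Γ (𝟏 ⇒ 𝟎 *)} → H ⊩ st Φ → H ⊩ st (image Φ)
  image-st d = closed (𝐒 · (𝐒 ∘ᵗ 𝐊)) ·ˢ (closed nth ∘ˢ d)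

  hit-st : {Φ : Tm Const Γ (𝟏 ⇒ 𝟎 *)} → H ⊩ st Φ → H ⊩ st (hit Φ)
  hit-st d = closed cond[ O , S · O ] ∘ˢ closed 𝐒 ·ˢ image-st d ·ˢ
    (closed 𝐒 ·ˢ (closed R₀ ∘ˢ closed len ∘ˢ d atˢ closed O) ·ˢ
     (closed find-step ∘ˢ image-st d))

  -- Without a standard zero of `g`, `complement g` vanishes on the standard numbers, hence by
  -- transfer everywhere, and `g` has no zero at all.
  standard-zero-∀ : H ⊩ ∀[ 𝟏 ] (ren from[] Π⁰₁-TRANS ⊃ st v0 ⊃ HasZero v0 ⊃
                                  (∃ˢᵗ[ 𝟎 ] v1 · v0 ≐ O))
  standard-zero-∀ = ∀I (⊃I (⊃I (⊃I (raa (∃E #1 (S≢O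
    (eq (complement-β ⨟ cond-O #0))
    (∀E (⊃E (⊃E (∀E #4 (complement v1)) (complement-st #3))
            (∀I (⊃I (eq (complement-β ⨟ cond-nonzero
              (⊃I (⊃E #3 (∃I v0 (∧I #1 #0)))))))))
        v0)))))))

  standard-zero : H ⊩ ren from[] Π⁰₁-TRANS → H ⊩ st g → H ⊩ HasZero g →
                  H ⊩ ∃ˢᵗ[ 𝟎 ] wkT g · v0 ≐ O
  standard-zero {g = g} d e f = ⊃E (⊃E (⊃E (∀E standard-zero-∀ g) d) e) f

  Σ⁰₁-st : H ⊩ ren from[] Π⁰₁-TRANS → H ⊩ st f → H ⊩ st n →
           H ⊩ Σ⁰₁ f n → H ⊩ (Σ⁰₁ f n) ˢᵗ
  Σ⁰₁-st d e f g = ∃-map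
    (standard-zero d (closed section ·ˢ e ·ˢ f) (section-zero g))
    (∧I (∧E₁ #0) (≋⊩ (≋sym section-β) (∧E₂ #0)))

  -- Transfer, (∃²) and standard separation

  ∃²⇒Π⁰₁-TRANS : H ⊩ ∃² → H ⊩ Π⁰₁-TRANS
  ∃²⇒Π⁰₁-TRANS d = ∃E (standard (∃²⇒zero-finder d))
    -- Where `f` does not vanish, `complement f` has a zero; the standard finder returns a standard
    -- one, at which `f` would have to vanish.
    (∀I (⊃I (⊃I (∀I (raa (⊃E
      (s̄g-O⁻¹ (≋⊩ (≋sym complement-β)
        (⊃E (∀E (∧E₂ #3) (complement v1))
            (∃I v0 (eq (complement-β ⨟ cond-nonzero #0))))))
      (⊃E (∀E #1 (v2 · complement v1)) (∧E₁ #3 ·ˢ complement-st #2))))))))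
    where
    -- The contrapositive of `PF-TP∀`: being a zero finder is internal and parameter-free.
    standard : H ⊩ ∃[ 𝟐 ] ZeroFinder v0 → H ⊩ ∃ˢᵗ[ 𝟐 ] ZeroFinder v0
    standard d = raa (∃E (↑ d) (⊃E
      (∀E (⊃E (axiom (PF-TP∀ (¬ᶠ ZeroFinder v0) _))
              (∀I (⊃I (⊃I (⊃E #3 (∃I v0 (∧I #1 #0)))))))
          v0)
      #0))

  Σ⁰₁-SEP*⇒Π⁰₁-TRANS : H ⊩ Σ⁰₁-SEP* → H ⊩ Π⁰₁-TRANS
  Σ⁰₁-SEP*⇒Π⁰₁-TRANS d = cut d (∀I (⊃I (⊃I (∀I (raa
    (∃E (⊃E (⊃E (∀E (⊃E (∀E #3 (spread (complement v1))) standard)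
                    (spread (complement v1))) standard)
            -- A standard witness at a standard number makes the search bound standard, so `find`
            -- would return a standard number at which `f` does not vanish.
            (∀I (⊃I (⊃I (∃E (∧E₁ #0)
              (⊃E (s̄g-O⁻¹ (≋⊩ (≋sym complement-β) (spread-O⁻¹ (∧E₂ #0))))
                  (⊃E (∀E #4 _)
                      (find-st (complement-st #5)
                               (closed S ·ˢ ⟨,⟩-st (∧E₁ #0) #2)))))))))
        -- Without relativisation, the assumed number where `f` does not vanish makes both formulas
        -- true at `O`, so `O` is both in the set and not in it.
        (cut (∃I v1 (spread-O (eq (complement-β ⨟ cond-nonzero #1))))
          (⊃E (⊃E (∧E₁ (∀E (∧E₂ (∧E₂ #1)) O)) #0)
              (⊃E (∧E₂ (∀E (∧E₂ (∧E₂ #1)) O)) #0)))))))))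
    where
    standard : {A : Form Const (𝟎 ∷ 𝟏 ∷ Γ)} →
               A ∷ B ∷ st v1 ∷ H ⊩ st (spread (complement v1))
    standard = spread-st (complement-st #2)

  Π⁰₁-TRANS⇒decides : H ⊩ Π⁰₁-TRANS → H ⊩ Decides (con E)
  Π⁰₁-TRANS⇒decides d = cut d (∃E
    (⊃E (axiom (HACint (HasZero v1 ⊃ v1 · v0 ≐ O) _))
        (∀I (⊃I (by-cases (HasZero v0)
          (∃-map (standard-zero #2 #1 #0) (∧I (∧E₁ #0) (⊃I (∧E₂ #1))))
          -- If `g` has no zero, the implication holds for any standard number.
          (∃I O (∧I (closed O) (⊃I (ex-falso (⊃E #1 #0)))))))))
    (cut agree
      (⊃E (axiom (PF-TP∀ (HasZero v0 ⇔ con E · v0 ≐ O) _))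
          (∀I (⊃I (∧I
            (⊃I (≋⊩ ⟪ ⊃E (∀E #2 v0) #1 ⟫
                    (selects-hit {Φ = v1} (∧E₂ #3) #1 #0)))
            (⊃I (∃I _ (hit-O⁻¹ (≋⊩ (≋sym ⟪ ⊃E (∀E #2 v0) #1 ⟫) #0))))))))))
    where
    -- `D E` is `∃²-spec` only up to the propositional equality `D-E`, along which the axiom is
    -- transported.
    Ξ₀-E : ∀ {Γ} → RCA₀Ω 𝒮 {Γ} (st (con E) ∧
             (∀ˢᵗ[ 𝟐 ] (ren (liftR from[]) (embed ∃²-spec) ˢᵗ ⊃
                        Eq 𝟐 (con E) v0 ˢᵗ)))
    Ξ₀-E {Γ} = subst
      (λ D → RCA₀Ω 𝒮 {Γ} (st (con E) ∧
               (∀ˢᵗ[ 𝟐 ] (ren (liftR from[]) (embed D) ˢᵗ ⊃ Eq 𝟐 (con E) v0 ˢᵗ))))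
      D-E (Ξ₀-axiom E)

    -- The axiom for `con E` asks `hit` to satisfy the relativised specification: its value zero
    -- must provide a standard zero of `g`, and its values must be at most 1.
    agree : (st v0 ∧ Selects v0) ∷ H ⊩ ∀ˢᵗ[ 𝟏 ] con E · v0 ≐ hit v1 · v0
    agree = ⊃E (⊃E (∀E (∧E₂ (axiom Ξ₀-E)) (hit v0)) (hit-st (∧E₁ #0)))
      (∀I (⊃I (∧I
        (∧I (⊃I (selects-hit {Φ = v1} (∧E₂ #2) #1 (∃-map #0 (∧E₂ #0))))
            (⊃I (∃I _ (∧I
              (closed nth ·ˢ (∧E₁ #2 ·ˢ #1) ·ˢ
                find-st (image-st (∧E₁ #2) ·ˢ #1) (closed len ·ˢ (∧E₁ #2 ·ˢ #1)))
              (hit-O⁻¹ #0)))))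
        hit-bit)))

  Π⁰₁-TRANS⇒∃² : H ⊩ Π⁰₁-TRANS → H ⊩ ∃²
  Π⁰₁-TRANS⇒∃² d = ∃I (con E) (Π⁰₁-TRANS⇒decides d)

  Π⁰₁-TRANS⇒Σ⁰₁-SEP* : H ⊩ Π⁰₁-TRANS → H ⊩ Σ⁰₁-SEP*
  Π⁰₁-TRANS⇒Σ⁰₁-SEP* d = cut d (cut (↑ Π⁰₁-TRANS⇒decides d)
    (∀I (⊃I (∀I (⊃I (⊃I (cut disjoint
      -- The set is the extension of φ₂, standard because `con E` and the second function are.
      (∃I (indicator (con E) · v0) (∧I (closed (indicator (con E)) ·ˢ #2)
        (∧I indicator-isSet
          (∀I (∧I
            (⊃I (⊃I (S≢O #0 (indicator-∉ {φ = con E} #6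
              (⊃I (⊃E #3 (∃I v0 (common-O {φ = con E} #7 (∧I #2 #0)))))))))
            (⊃I (indicator-∈ {φ = con E} #5 #0))))))))))))))
    where
    -- A number in both extensions is a zero of the standard `common`, so transfer gives a standard
    -- such number and then standard witnesses for both formulas, against the hypothesis.
    disjoint : (∀ˢᵗ[ 𝟎 ] ¬ᶠ ((Σ⁰₁ v2 v0 ˢᵗ) ∧ (Σ⁰₁ v1 v0 ˢᵗ))) ∷
               st v0 ∷ st v1 ∷ Decides (con E) ∷ ren from[] Π⁰₁-TRANS ∷ H ⊩
               ¬ᶠ HasZero (common (con E) v1 v0)
    disjoint = ⊃I (∃E (standard-zero #5 (common-st #3 #2) #0)
      (cut (common-O⁻¹ {φ = con E} #5 (∧E₂ #0))
        (⊃E (⊃E (∀E #3 v0) (∧E₁ #1))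
            (∧I (Σ⁰₁-st #7 #5 (∧E₁ #1) (∧E₁ #0))
                (Σ⁰₁-st #7 #4 (∧E₁ #1) (∧E₂ #0))))))

-- Composition of the implications

corollary3p9 : (𝒮 : Specification) →
    (RCA₀Ω 𝒮 ⊢ Π⁰₁-TRANS ⇔ Σ⁰₁-SEP*) ×
    (RCA₀Ω 𝒮 ⊢ Σ⁰₁-SEP* ⇔ UΣ⁰₁-SEP) ×
    (RCA₀Ω 𝒮 ⊢ UΣ⁰₁-SEP ⇔ ∃²)
corollary3p9 𝒮 =
  ∧I (⊃I (Π⁰₁-TRANS⇒Σ⁰₁-SEP* #0)) (⊃I (Σ⁰₁-SEP*⇒Π⁰₁-TRANS #0)) ,
  ∧I (⊃I (∃²⇒UΣ⁰₁-SEP (Π⁰₁-TRANS⇒∃² (Σ⁰₁-SEP*⇒Π⁰₁-TRANS #0))))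
     (⊃I (Π⁰₁-TRANS⇒Σ⁰₁-SEP* (∃²⇒Π⁰₁-TRANS (UΣ⁰₁-SEP⇒∃² #0)))) ,
  ∧I (⊃I (UΣ⁰₁-SEP⇒∃² #0)) (⊃I (∃²⇒UΣ⁰₁-SEP #0))
  where
  open Nonstandard 𝒮
  open Arithmetic (RCA₀Ω 𝒮) base
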